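{- Let $n\ge 3$, and let the group algebra $\mathbb{Q}\mathfrak{S}_n$ of the symmetric group $\mathfrak{S}_n$ act on $\mathbb{Q}[x_1,\dots,x_n,y_1,\dots,y_n]$ by the diagonal Hivert action $*$, i.e. the linear action determined on monomials by $\sigma * (\mathbf{x}\mathbf{y})_{\mathbf i}^{\mathfrak a} = (\mathbf{x}\mathbf{y})_{\sigma\cdot\mathbf i}^{\mathfrak a}$. Then the kernel $\mathrm{Ker}_n\subseteq \mathbb{Q}\mathfrak{S}_n$ of this action (the set of elements of $\mathbb{Q}\mathfrak{S}_n$ acting as zero) is the two-sided ideal of $\mathbb{Q}\mathfrak{S}_n$ generated by the element $$E_{\{1,2,3\}} = 1\,2\,3\,4\cdots n - 1\,3\,2\,4\cdots n - 2\,1\,3\,4\cdots n + 2\,3\,1\,4\cdots n + 3\,1\,2\,4\cdots n - 3\,2\,1\,4\cdots n,$$ where permutations are written in one-line notation. Thus $\mathrm{TL}_n\simeq \mathbb{Q}\mathfrak{S}_n/\mathrm{Ker}_n$, and $\mathrm{TL}_n$ acts faithfully on $\mathbb{Q}[x_1,\dots,x_n,y_1,\dots,y_n]$.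
   Context: Notation for monomials. A bicomposition of length $k$ is a sequence $\mathfrak a=(\alpha_1,\dots,\alpha_k)$ of nonzero vectors $\alpha_m=(a_m,b_m)\in\mathbb{N}\times\mathbb{N}$ (where $0\in\mathbb N$); there is one empty bicomposition, of length $0$. For a subset $\mathbf i=\{i_1<i_2<\dots<i_k\}$ of $\{1,\dots,n\}$ and a bicomposition $\mathfrak a$ of length $k=|\mathbf i|$, set $$(\mathbf{x}\mathbf{y})_{\mathbf i}^{\mathfrak a} := (x_{i_1}^{a_1}y_{i_1}^{b_1})(x_{i_2}^{a_2}y_{i_2}^{b_2})\cdots(x_{i_k}^{a_k}y_{i_k}^{b_k}).$$ Every monomial in $\mathbb{Q}[x_1,\dots,x_n,y_1,\dots,y_n]$ is uniquely of this form (the monomial $1$ corresponds to $\mathbf i=\emptyset$). Action. For $\sigma\in\mathfrak{S}_n$, $\sigma\cdot\mathbf i:=\{\sigma(i)\mid i\in\mathbf i\}$, and $\sigma * (\mathbf{x}\mathbf{y})_{\mathbf i}^{\mathfrak a} := (\mathbf{x}\mathbf{y})_{\sigma\cdot\mathbf i}^{\mathfrak a}$, where the elements of $\sigma\cdot\mathbf i$ are re-listed in increasing order before the exponents $\alpha_1,\dots,\alpha_k$ are attached in order. This is extended linearly to $\mathbb{Q}\mathfrak{S}_n$ and to all polynomials. (It does not preserve the multiplication of polynomials.) Temperley-Lieb algebra. $\mathrm{TL}_n(q)$ is the quotient of the Hecke algebra of $\mathfrak{S}_n$, with standard generators $T_1,\dots,T_{n-1}$, by the relations $e_ie_{i\pm1}e_i=\frac{q}{(1+q)^2}e_i$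 whenever the indices $i, i\pm 1$ lie in $\{1,\dots,n-1\}$, where $e_i:=(q-T_i)/(1+q)$. Here $\mathrm{TL}_n$ denotes the specialization at $q=1$: the quotient of the $\mathbb{Q}$-algebra $\mathbb{Q}\mathfrak{S}_n$ by the relations $e_ie_{i\pm1}e_i=\frac14 e_i$, where $e_i=\frac12(1-s_i)$ and $s_i$ is the transposition $(i,\,i+1)$. -}

module Defs where

open import Algebra.Bundles using (Ring; Group)
open import Algebra.Module.Bundles using (LeftModule)
open import Algebra.Module.Structures using (IsLeftModule)
open import Algebra.Morphism.Structures using (module RingMorphisms)
import Algebra.Properties.AbelianGroup as AbelianGroupProperties
import Algebra.Properties.CommutativeMonoid.Sum as Sums
import Algebra.Properties.CommutativeSemigroup as CommutativeSemigroupProperties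
import Algebra.Properties.Ring as RingProperties
open import Data.Bool.Base using (Bool; true; false; if_then_else_)
open import Data.Fin.Base as Fin using (Fin; toℕ; inject₁)
open import Data.Fin.Patterns using (0F; 1F; 2F)
open import Data.Fin.Permutation as Perm
  using (Permutation′; _⟨$⟩ʳ_; _⟨$⟩ˡ_; permutation; transpose)
open import Data.Fin.Properties as Finₚ using (+↔⊎)
open import Data.Fin.Subset using (Subset; inside; outside; ∣_∣; _∈_)
open import Data.Integer.Base using (1ℤ)
open import Data.List.Base using (List; []; _∷_; _++_; map; cartesianProductWith; length)
open import Data.Nat.Base as ℕ using (ℕ; zero; suc; pred; z≤n; s≤s)
open import Data.Nat.Properties as ℕₚ using ()
open import Data.Product.Base using (Σ; ∃-syntax; _×_; _,_)
open import Data.Product.Properties using (≡-dec)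
open import Data.Rational.Base as ℚ using (ℚ; 0ℚ; 1ℚ; ½; _/_)
open import Data.Rational.Properties as ℚₚ using ()
open import Data.Sum.Base using (_⊎_)
open import Data.Sum.Function.Propositional using (_⊎-↔_)
open import Data.Vec.Base as Vec using (Vec; []; _∷_; lookup; tabulate)
import Data.Vec.Properties as Vecₚ
open import Data.Vec.Relation.Unary.All using (All; []; _∷_)
open import Function.Base using (_∘_)
open import Function.Bundles using (_⇔_; mk⇔)
open import Function.Construct.Composition using (_↔-∘_)
open import Function.Construct.Identity using (↔-id)
open import Function.Construct.Symmetry using (↔-sym)
open import Level using (0ℓ)
open import Relation.Binary.Bundles using (DecSetoid)
open import Relation.Binary.Definitions using (Decidable)
open import Relation.Binary.PropositionalEquality
  using (_≡_; _≢_; refl; sym; trans; cong; cong₂; subst; module ≡-Reasoning)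
import Relation.Binary.PropositionalEquality as ≡
open import Relation.Nullary using (does; yes; no; contradiction)
open import Relation.Nullary.Decidable using (True; toWitness)
open import Relation.Unary using (Pred)

ℚ-ring : Ring 0ℓ 0ℓ
ℚ-ring = ℚₚ.+-*-ring

record ℚ-Algebra : Set₁ where
  infixr 7 _·_
  field
    ring         : Ring 0ℓ 0ℓ
  open Ring ring public
  field
    _·_          : ℚ → Carrier → Carrier
    isLeftModule : IsLeftModule ℚ-ring _≈_ _+_ 0# -_ _·_
    ·-*-assoc    : ∀ c x y → ((c · x) * y) ≈ (c · (x * y))
    *-·-comm     : ∀ c x y → (x * (c · y)) ≈ (c · (x * y))

record IsℚAlgebraIsomorphism (A B : ℚ-Algebra)
    (f : ℚ-Algebra.Carrier A → ℚ-Algebra.Carrier B) : Set where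
  private
    module A = ℚ-Algebra A
    module B = ℚ-Algebra B
  field
    isRingIsomorphism : RingMorphisms.IsRingIsomorphism A.rawRing B.rawRing f
    ·-homo            : ∀ c x → f (c A.· x) B.≈ c B.· f x

module _ (R : Ring 0ℓ 0ℓ) where
  open Ring R hiding (zero; refl; sym; trans)

  record TwoSidedIdeal : Set₁ where
    field
      member   : Pred Carrier 0ℓ
      resp     : ∀ {x y} → x ≈ y → member x → member y
      0-closed : member 0#
      +-closed : ∀ {x y} → member x → member y → member (x + y)
      *-closedˡ : ∀ r {x} → member x → member (r * x)
      *-closedʳ : ∀ {x} r → member x → member (x * r)

  data Generated (G : Pred Carrier 0ℓ) : Pred Carrier 0ℓ where
    gen     : ∀ {x} → G x → Generated G x
    gen-≈   : ∀ {x y} → x ≈ y → Generated G x → Generated G y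
    gen-0   : Generated G 0#
    gen-+   : ∀ {x y} → Generated G x → Generated G y → Generated G (x + y)
    gen-*ˡ  : ∀ r {x} → Generated G x → Generated G (r * x)
    gen-*ʳ  : ∀ {x} r → Generated G x → Generated G (x * r)

  ⟨_⟩ : Pred Carrier 0ℓ → TwoSidedIdeal
  ⟨ G ⟩ = record
    { member    = Generated G
    ; resp      = gen-≈
    ; 0-closed  = gen-0
    ; +-closed  = gen-+
    ; *-closedˡ = gen-*ˡ
    ; *-closedʳ = gen-*ʳ
    }

  Faithful : LeftModule R 0ℓ 0ℓ → Set
  Faithful M = ∀ r s → (∀ m → (r *ₗ m) ≈ᴹ (s *ₗ m)) → r ≈ s
    where open LeftModule M

  Annihilator : LeftModule R 0ℓ 0ℓ → TwoSidedIdeal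
  Annihilator M = record
    { member    = λ r → ∀ m → (r *ₗ m) ≈ᴹ 0ᴹ
    ; resp      = λ x≈y k m → ≈ᴹ-trans (*ₗ-congʳ (Ring.sym R x≈y)) (k m)
    ; 0-closed  = *ₗ-zeroˡ
    ; +-closed  = λ k l m → ≈ᴹ-trans (*ₗ-distribʳ m _ _)
                    (≈ᴹ-trans (+ᴹ-cong (k m) (l m)) (+ᴹ-identityˡ 0ᴹ))
    ; *-closedˡ = λ r k m → ≈ᴹ-trans (*ₗ-assoc r _ m)
                    (≈ᴹ-trans (*ₗ-congˡ (k m)) (*ₗ-zeroʳ r))
    ; *-closedʳ = λ r k m → ≈ᴹ-trans (*ₗ-assoc _ r m) (k (r *ₗ m))
    }
    where open LeftModule M

-- The quotient has the same carrier, so that the canonical projection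
-- is the identity function; only the equality is coarsened.
module Quotient (A : ℚ-Algebra) (I : TwoSidedIdeal (ℚ-Algebra.ring A)) where
  open ℚ-Algebra A hiding (zero; refl; sym; trans)
  open TwoSidedIdeal I
  open AbelianGroupProperties +-abelianGroup
    using (x≈y⇒x∙y⁻¹≈ε; ⁻¹-anti-homo‿-; ⁻¹-∙-comm)
  open RingProperties ring using (-1*x≈-x; x[y-z]≈xy-xz; [y-z]x≈yx-zx)
  open CommutativeSemigroupProperties
    (Ring.+-commutativeSemigroup ring) using (interchange)
  open import Relation.Binary.Reasoning.Setoid setoid
  private
    module L = IsLeftModule isLeftModule

  infix 4 _~_
  _~_ : Carrier → Carrier → Set
  x ~ y = member (x - y)

  ≈⇒~ : ∀ {x y} → x ≈ y → x ~ y
  ≈⇒~ x≈y = resp (Ring.sym ring (x≈y⇒x∙y⁻¹≈ε x≈y)) 0-closed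

  neg : ∀ {x} → member x → member (- x)
  neg m = resp (-1*x≈-x _) (*-closedˡ (- 1#) m)

  ~-sym : ∀ {x y} → x ~ y → y ~ x
  ~-sym {x} {y} m = resp (⁻¹-anti-homo‿- x y) (neg m)

  telescope : ∀ x y z → (x - y) + (y - z) ≈ x - z
  telescope x y z = begin
    (x - y) + (y - z)      ≈⟨ +-assoc x (- y) (y - z) ⟩
    x + (- y + (y - z))    ≈⟨ +-congˡ (Ring.sym ring (+-assoc (- y) y (- z))) ⟩
    x + ((- y + y) - z)    ≈⟨ +-congˡ (+-congʳ (-‿inverseˡ y)) ⟩
    x + (0# - z)           ≈⟨ +-congˡ (+-identityˡ (- z)) ⟩
    x - z                  ∎

  ~-trans : ∀ {x y z} → x ~ y → y ~ z → x ~ z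
  ~-trans {x} {y} {z} m k = resp (telescope x y z) (+-closed m k)

  +-~ : ∀ {x y u v} → x ~ y → u ~ v → x + u ~ y + v
  +-~ {x} {y} {u} {v} m k = resp eq (+-closed m k)
    where
    eq : (x - y) + (u - v) ≈ (x + u) - (y + v)
    eq = begin
      (x - y) + (u - v)        ≈⟨ interchange x (- y) u (- v) ⟩
      (x + u) + (- y + - v)    ≈⟨ +-congˡ (⁻¹-∙-comm y v) ⟩
      (x + u) - (y + v)        ∎

  neg-~ : ∀ {x y} → x ~ y → - x ~ - y
  neg-~ {x} {y} m = resp (Ring.sym ring (⁻¹-∙-comm x (- y))) (neg m)

  *-~ : ∀ {x y u v} → x ~ y → u ~ v → x * u ~ y * v
  *-~ {x} {y} {u} {v} m k = ~-trans
    (resp ([y-z]x≈yx-zx u x y) (*-closedʳ u m))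
    (resp (x[y-z]≈xy-xz y u v) (*-closedˡ y k))

  ·-via-* : ∀ c x → (c · 1#) * x ≈ c · x
  ·-via-* c x = Ring.trans ring (·-*-assoc c 1# x) (L.*ₗ-congˡ (*-identityˡ x))

  ·-~ : ∀ {c d x y} → c ≡ d → x ~ y → c · x ~ d · y
  ·-~ {c} {_} {x} {y} refl m = ~-trans (≈⇒~ (Ring.sym ring (·-via-* c x)))
    (~-trans (*-~ (≈⇒~ (Ring.refl ring)) m) (≈⇒~ (·-via-* c y)))

  quotientRing : Ring 0ℓ 0ℓ
  quotientRing = record
    { Carrier = Carrier
    ; _≈_ = _~_
    ; _+_ = _+_
    ; _*_ = _*_
    ; -_  = -_
    ; 0#  = 0#
    ; 1#  = 1#
    ; isRing = record
      { +-isAbelianGroup = record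
        { isGroup = record
          { isMonoid = record
            { isSemigroup = record
              { isMagma = record
                { isEquivalence = record
                  { refl = ≈⇒~ (Ring.refl ring) ; sym = ~-sym ; trans = ~-trans }
                ; ∙-cong = +-~
                }
              ; assoc = λ x y z → ≈⇒~ (+-assoc x y z)
              }
            ; identity = (λ x → ≈⇒~ (+-identityˡ x)) , (λ x → ≈⇒~ (+-identityʳ x))
            }
          ; inverse = (λ x → ≈⇒~ (-‿inverseˡ x)) , (λ x → ≈⇒~ (-‿inverseʳ x))
          ; ⁻¹-cong = neg-~
          }
        ; comm = λ x y → ≈⇒~ (+-comm x y)
        }
      ; *-cong = *-~
      ; *-assoc = λ x y z → ≈⇒~ (*-assoc x y z)
      ; *-identity = (λ x → ≈⇒~ (*-identityˡ x)) , (λ x → ≈⇒~ (*-identityʳ x))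
      ; distrib = (λ x y z → ≈⇒~ (distribˡ x y z)) , (λ x y z → ≈⇒~ (distribʳ x y z))
      }
    }

  quotient : ℚ-Algebra
  quotient = record
    { ring = quotientRing
    ; _·_ = _·_
    ; isLeftModule = record
      { isLeftSemimodule = record
        { +ᴹ-isCommutativeMonoid = Ring.+-isCommutativeMonoid quotientRing
        ; isPreleftSemimodule = record
          { *ₗ-cong      = ·-~
          ; *ₗ-zeroˡ     = λ x → ≈⇒~ (L.*ₗ-zeroˡ x)
          ; *ₗ-distribʳ  = λ x c d → ≈⇒~ (L.*ₗ-distribʳ x c d)
          ; *ₗ-identityˡ = λ x → ≈⇒~ (L.*ₗ-identityˡ x)
          ; *ₗ-assoc     = λ c d x → ≈⇒~ (L.*ₗ-assoc c d x)
          ; *ₗ-zeroʳ     = λ c → ≈⇒~ (L.*ₗ-zeroʳ c)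
          ; *ₗ-distribˡ  = λ c x y → ≈⇒~ (L.*ₗ-distribˡ c x y)
          }
        }
      ; -ᴹ‿cong = neg-~
      ; -ᴹ‿inverse = Ring.-‿inverse quotientRing
      }
    ; ·-*-assoc = λ c x y → ≈⇒~ (·-*-assoc c x y)
    ; *-·-comm  = λ c x y → ≈⇒~ (*-·-comm c x y)
    }

infixl 6 _/ᴬ_
_/ᴬ_ : (A : ℚ-Algebra) → TwoSidedIdeal (ℚ-Algebra.ring A) → ℚ-Algebra
A /ᴬ I = Quotient.quotient A I

-- The free ℚ-module on S: formal linear combinations, not necessarily
-- reduced, two of which are equal when all their coefficients agree.
module Free (S : DecSetoid 0ℓ 0ℓ) where
  open DecSetoid S using (_≟_) renaming (Carrier to B; _≈_ to _≈ᴮ_)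
  private
    module S = DecSetoid S
  open ≡-Reasoning

  Comb : Set
  Comb = List (ℚ × B)

  coeff : Comb → B → ℚ
  coeff []            s = 0ℚ
  coeff ((c , t) ∷ u) s = (if does (t ≟ s) then c else 0ℚ) ℚ.+ coeff u s

  infix 4 _≈_
  record _≈_ (u v : Comb) : Set where
    constructor mk≈
    field coeff-≡ : ∀ s → coeff u s ≡ coeff v s
  open _≈_ public

  infixr 7 _·_
  _·_ : ℚ → Comb → Comb
  c · u = map (λ (d , s) → c ℚ.* d , s) u

  -_ : Comb → Comb
  - u = (ℚ.- 1ℚ) · u

  -- The value at u of the linear functional B → ℚ extended from h.
  eval : (B → ℚ) → Comb → ℚ
  eval h []            = 0ℚ
  eval h ((c , s) ∷ u) = c ℚ.* h s ℚ.+ eval h u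

  Cong : (B → ℚ) → Set
  Cong h = ∀ {s t} → s ≈ᴮ t → h s ≡ h t

  δ : B → B → ℚ
  δ s t = if does (t ≟ s) then 1ℚ else 0ℚ

  δ-cong : ∀ s → Cong (δ s)
  δ-cong s {t} {t′} t≈t′ with t ≟ s | t′ ≟ s
  ... | yes _   | yes _    = refl
  ... | no  _   | no  _    = refl
  ... | yes t≈s | no  t′≉s = contradiction (S.trans (S.sym t≈t′) t≈s) t′≉s
  ... | no  t≉s | yes t′≈s = contradiction (S.trans t≈t′ t′≈s) t≉s

  coeff-eval : ∀ u s → coeff u s ≡ eval (δ s) u
  coeff-eval []            s = refl
  coeff-eval ((c , t) ∷ u) s with does (t ≟ s)
  ... | true  = cong₂ ℚ._+_ (sym (ℚₚ.*-identityʳ c)) (coeff-eval u s)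
  ... | false = cong₂ ℚ._+_ (sym (ℚₚ.*-zeroʳ c)) (coeff-eval u s)

  +-swap : ∀ a b c → a ℚ.+ (b ℚ.+ c) ≡ b ℚ.+ (a ℚ.+ c)
  +-swap a b c = trans (sym (ℚₚ.+-assoc a b c))
    (trans (cong (ℚ._+ c) (ℚₚ.+-comm a b)) (ℚₚ.+-assoc b a c))

  remove : B → Comb → Comb
  remove s []            = []
  remove s ((c , t) ∷ u) = if does (t ≟ s) then remove s u else (c , t) ∷ remove s u

  remove-length : ∀ s u → length (remove s u) ℕ.≤ length u
  remove-length s []            = z≤n
  remove-length s ((c , t) ∷ u) with does (t ≟ s)
  ... | true  = ℕₚ.m≤n⇒m≤1+n (remove-length s u)
  ... | false = s≤s (remove-length s u)

  remove-eval : ∀ h → Cong h → ∀ s u →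
                eval h u ≡ coeff u s ℚ.* h s ℚ.+ eval h (remove s u)
  remove-eval h hc s [] = begin
    0ℚ                     ≡⟨ ℚₚ.+-identityʳ 0ℚ ⟨
    0ℚ ℚ.+ 0ℚ              ≡⟨ cong (ℚ._+ 0ℚ) (ℚₚ.*-zeroˡ (h s)) ⟨
    0ℚ ℚ.* h s ℚ.+ 0ℚ      ∎
  remove-eval h hc s ((c , t) ∷ u) with t ≟ s
  ... | yes t≈s = begin
    c ℚ.* h t ℚ.+ eval h u
      ≡⟨ cong₂ (λ a b → c ℚ.* a ℚ.+ b) (hc t≈s) (remove-eval h hc s u) ⟩
    c ℚ.* h s ℚ.+ (coeff u s ℚ.* h s ℚ.+ eval h (remove s u))
      ≡⟨ ℚₚ.+-assoc (c ℚ.* h s) _ _ ⟨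
    (c ℚ.* h s ℚ.+ coeff u s ℚ.* h s) ℚ.+ eval h (remove s u)
      ≡⟨ cong (ℚ._+ eval h (remove s u)) (ℚₚ.*-distribʳ-+ (h s) c (coeff u s)) ⟨
    (c ℚ.+ coeff u s) ℚ.* h s ℚ.+ eval h (remove s u) ∎
  ... | no _ = begin
    c ℚ.* h t ℚ.+ eval h u
      ≡⟨ cong (c ℚ.* h t ℚ.+_) (remove-eval h hc s u) ⟩
    c ℚ.* h t ℚ.+ (coeff u s ℚ.* h s ℚ.+ eval h (remove s u))
      ≡⟨ +-swap (c ℚ.* h t) (coeff u s ℚ.* h s) (eval h (remove s u)) ⟩
    coeff u s ℚ.* h s ℚ.+ (c ℚ.* h t ℚ.+ eval h (remove s u))
      ≡⟨ cong (λ a → a ℚ.* h s ℚ.+ (c ℚ.* h t ℚ.+ eval h (remove s u))) (ℚₚ.+-identityˡ (coeff u s)) ⟨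
    (0ℚ ℚ.+ coeff u s) ℚ.* h s ℚ.+ (c ℚ.* h t ℚ.+ eval h (remove s u)) ∎

  eval-++ : ∀ h u v → eval h (u ++ v) ≡ eval h u ℚ.+ eval h v
  eval-++ h []            v = sym (ℚₚ.+-identityˡ _)
  eval-++ h ((c , s) ∷ u) v =
    trans (cong (c ℚ.* h s ℚ.+_) (eval-++ h u v))
          (sym (ℚₚ.+-assoc (c ℚ.* h s) (eval h u) (eval h v)))

  eval-· : ∀ h c u → eval h (c · u) ≡ c ℚ.* eval h u
  eval-· h c []            = sym (ℚₚ.*-zeroʳ c)
  eval-· h c ((d , s) ∷ u) =
    trans (cong₂ ℚ._+_ (ℚₚ.*-assoc c d (h s)) (eval-· h c u))
          (sym (ℚₚ.*-distribˡ-+ c _ _))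

  eval-ext : ∀ {g h} → (∀ s → g s ≡ h s) → ∀ u → eval g u ≡ eval h u
  eval-ext g≡h []            = refl
  eval-ext g≡h ((c , s) ∷ u) =
    cong₂ (λ a b → c ℚ.* a ℚ.+ b) (g≡h s) (eval-ext g≡h u)

  eval-+ : ∀ g h u → eval (λ s → g s ℚ.+ h s) u ≡ eval g u ℚ.+ eval h u
  eval-+ g h [] = refl
  eval-+ g h ((c , s) ∷ u) = begin
    c ℚ.* (g s ℚ.+ h s) ℚ.+ eval (λ s → g s ℚ.+ h s) u
      ≡⟨ cong₂ ℚ._+_ (ℚₚ.*-distribˡ-+ c (g s) (h s)) (eval-+ g h u) ⟩
    (c ℚ.* g s ℚ.+ c ℚ.* h s) ℚ.+ (eval g u ℚ.+ eval h u)
      ≡⟨ ℚₚ.+-assoc (c ℚ.* g s) _ _ ⟩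
    c ℚ.* g s ℚ.+ (c ℚ.* h s ℚ.+ (eval g u ℚ.+ eval h u))
      ≡⟨ cong (c ℚ.* g s ℚ.+_) (+-swap (c ℚ.* h s) (eval g u) (eval h u)) ⟩
    c ℚ.* g s ℚ.+ (eval g u ℚ.+ (c ℚ.* h s ℚ.+ eval h u))
      ≡⟨ ℚₚ.+-assoc (c ℚ.* g s) _ _ ⟨
    (c ℚ.* g s ℚ.+ eval g u) ℚ.+ (c ℚ.* h s ℚ.+ eval h u) ∎

  eval-* : ∀ c h u → eval (λ s → c ℚ.* h s) u ≡ c ℚ.* eval h u
  eval-* c h [] = sym (ℚₚ.*-zeroʳ c)
  eval-* c h ((d , s) ∷ u) = begin
    d ℚ.* (c ℚ.* h s) ℚ.+ eval (λ s → c ℚ.* h s) u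
      ≡⟨ cong₂ ℚ._+_ (trans (sym (ℚₚ.*-assoc d c (h s)))
           (trans (cong (ℚ._* h s) (ℚₚ.*-comm d c)) (ℚₚ.*-assoc c d (h s))))
           (eval-* c h u) ⟩
    c ℚ.* (d ℚ.* h s) ℚ.+ c ℚ.* eval h u  ≡⟨ ℚₚ.*-distribˡ-+ c _ _ ⟨
    c ℚ.* (d ℚ.* h s ℚ.+ eval h u)        ∎

  eval-0 : ∀ u → eval (λ _ → 0ℚ) u ≡ 0ℚ
  eval-0 []            = refl
  eval-0 ((c , s) ∷ u) = cong₂ ℚ._+_ (ℚₚ.*-zeroʳ c) (eval-0 u)

  remove-self : ∀ c s u → remove s ((c , s) ∷ u) ≡ remove s u
  remove-self c s u with s ≟ s
  ... | yes _  = refl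
  ... | no s≉s = contradiction S.refl s≉s

  coeff-remove : ∀ s u → (∀ t → coeff u t ≡ 0ℚ) → ∀ t → coeff (remove s u) t ≡ 0ℚ
  coeff-remove s u u≡0 t = begin
    coeff (remove s u) t                                ≡⟨ coeff-eval (remove s u) t ⟩
    eval (δ t) (remove s u)                             ≡⟨ ℚₚ.+-identityˡ _ ⟨
    0ℚ ℚ.+ eval (δ t) (remove s u)                      ≡⟨ cong (ℚ._+ eval (δ t) (remove s u)) (ℚₚ.*-zeroˡ (δ t s)) ⟨
    0ℚ ℚ.* δ t s ℚ.+ eval (δ t) (remove s u)            ≡⟨ cong (λ a → a ℚ.* δ t s ℚ.+ eval (δ t) (remove s u)) (u≡0 s) ⟨
    coeff u s ℚ.* δ t s ℚ.+ eval (δ t) (remove s u)     ≡⟨ remove-eval (δ t) (δ-cong t) s u ⟨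
    eval (δ t) u                                        ≡⟨ coeff-eval u t ⟨
    coeff u t                                           ≡⟨ u≡0 t ⟩
    0ℚ                                                  ∎

  eval-zero : ∀ k u → length u ℕ.≤ k → (∀ t → coeff u t ≡ 0ℚ) →
              ∀ h → Cong h → eval h u ≡ 0ℚ
  eval-zero k       []              _          _   h hc = refl
  eval-zero (suc k) w@((c , s) ∷ u) (s≤s ∣u∣≤k) w≡0 h hc = begin
    eval h w                                        ≡⟨ remove-eval h hc s w ⟩
    coeff w s ℚ.* h s ℚ.+ eval h (remove s w)       ≡⟨ cong₂ (λ a b → a ℚ.* h s ℚ.+ b) (w≡0 s) rest ⟩
    0ℚ ℚ.* h s ℚ.+ 0ℚ                               ≡⟨ ℚₚ.+-identityʳ _ ⟩
    0ℚ ℚ.* h s                                      ≡⟨ ℚₚ.*-zeroˡ (h s) ⟩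
    0ℚ                                              ∎
    where
    rest : eval h (remove s w) ≡ 0ℚ
    rest = eval-zero k (remove s w)
      (subst (λ z → length z ℕ.≤ k) (sym (remove-self c s u))
        (ℕₚ.≤-trans (remove-length s u) ∣u∣≤k))
      (coeff-remove s w w≡0) h hc

  eval-neg : ∀ h u → eval h (- u) ≡ ℚ.- eval h u
  eval-neg h u = trans (eval-· h (ℚ.- 1ℚ) u) (RingProperties.-1*x≈-x ℚ-ring (eval h u))

  eval-diff : ∀ h u v → eval h (u ++ (- v)) ≡ eval h u ℚ.- eval h v
  eval-diff h u v = trans (eval-++ h u (- v)) (cong (eval h u ℚ.+_) (eval-neg h v))

  eval-cong : ∀ {h u v} → Cong h → u ≈ v → eval h u ≡ eval h v
  eval-cong {h} {u} {v} hc u≈v =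
    AbelianGroupProperties.x∙y⁻¹≈ε⇒x≈y ℚₚ.+-0-abelianGroup _ _
      (trans (sym (eval-diff h u v)) (eval-zero _ (u ++ (- v)) ℕₚ.≤-refl zeros h hc))
    where
    zeros : ∀ t → coeff (u ++ (- v)) t ≡ 0ℚ
    zeros t = begin
      coeff (u ++ (- v)) t              ≡⟨ coeff-eval (u ++ (- v)) t ⟩
      eval (δ t) (u ++ (- v))           ≡⟨ eval-diff (δ t) u v ⟩
      eval (δ t) u ℚ.- eval (δ t) v     ≡⟨ cong₂ ℚ._-_ (sym (coeff-eval u t)) (sym (coeff-eval v t)) ⟩
      coeff u t ℚ.- coeff v t           ≡⟨ cong (ℚ._- coeff v t) (coeff-≡ u≈v t) ⟩
      coeff v t ℚ.- coeff v t           ≡⟨ ℚₚ.+-inverseʳ (coeff v t) ⟩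
      0ℚ                                ∎

  eval-sep : ∀ {u v} → (∀ h → Cong h → eval h u ≡ eval h v) → u ≈ v
  eval-sep {u} {v} eq = mk≈ λ s →
    trans (coeff-eval u s) (trans (eq (δ s) (δ-cong s)) (sym (coeff-eval v s)))

  private
    ++-cong : ∀ {u u′ v v′} → u ≈ u′ → v ≈ v′ → u ++ v ≈ u′ ++ v′
    ++-cong {u} {u′} {v} {v′} p q = eval-sep λ h hc →
      trans (eval-++ h u v)
        (trans (cong₂ ℚ._+_ (eval-cong hc p) (eval-cong hc q)) (sym (eval-++ h u′ v′)))

    ++-assoc : ∀ u v w → (u ++ v) ++ w ≈ u ++ (v ++ w)
    ++-assoc u v w = eval-sep λ h _ → begin
      eval h ((u ++ v) ++ w)               ≡⟨ eval-++ h (u ++ v) w ⟩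
      eval h (u ++ v) ℚ.+ eval h w         ≡⟨ cong (ℚ._+ eval h w) (eval-++ h u v) ⟩
      (eval h u ℚ.+ eval h v) ℚ.+ eval h w ≡⟨ ℚₚ.+-assoc (eval h u) _ _ ⟩
      eval h u ℚ.+ (eval h v ℚ.+ eval h w) ≡⟨ cong (eval h u ℚ.+_) (eval-++ h v w) ⟨
      eval h u ℚ.+ eval h (v ++ w)         ≡⟨ eval-++ h u (v ++ w) ⟨
      eval h (u ++ (v ++ w))               ∎

    ++-comm : ∀ u v → u ++ v ≈ v ++ u
    ++-comm u v = eval-sep λ h _ →
      trans (eval-++ h u v) (trans (ℚₚ.+-comm (eval h u) _) (sym (eval-++ h v u)))

    ++-identityʳ : ∀ u → u ++ [] ≈ u
    ++-identityʳ u = eval-sep λ h _ → trans (eval-++ h u []) (ℚₚ.+-identityʳ _)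

    ·-cong : ∀ {c d u v} → c ≡ d → u ≈ v → c · u ≈ d · v
    ·-cong {c} {_} {u} {v} refl p = eval-sep λ h hc →
      trans (eval-· h c u) (trans (cong (c ℚ.*_) (eval-cong hc p)) (sym (eval-· h c v)))

    -‿inverseʳ : ∀ u → u ++ (- u) ≈ []
    -‿inverseʳ u = eval-sep λ h _ → trans (eval-diff h u u) (ℚₚ.+-inverseʳ (eval h u))

    ≈-trans : ∀ {u v w} → u ≈ v → v ≈ w → u ≈ w
    ≈-trans p q = mk≈ λ s → trans (coeff-≡ p s) (coeff-≡ q s)

  freeModule : LeftModule ℚ-ring 0ℓ 0ℓ
  freeModule = record
    { Carrierᴹ = Comb
    ; _≈ᴹ_ = _≈_
    ; _+ᴹ_ = _++_
    ; _*ₗ_ = _·_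
    ; 0ᴹ = []
    ; -ᴹ_ = -_
    ; isLeftModule = record
      { isLeftSemimodule = record
        { +ᴹ-isCommutativeMonoid = record
          { isMonoid = record
            { isSemigroup = record
              { isMagma = record
                { isEquivalence = record
                  { refl  = mk≈ λ _ → refl
                  ; sym   = λ p → mk≈ (sym ∘ coeff-≡ p)
                  ; trans = ≈-trans
                  }
                ; ∙-cong = ++-cong
                }
              ; assoc = ++-assoc
              }
            ; identity = (λ _ → mk≈ λ _ → refl) , ++-identityʳ
            }
          ; comm = ++-comm
          }
        ; isPreleftSemimodule = record
          { *ₗ-cong = ·-cong
          ; *ₗ-zeroˡ = λ u → eval-sep λ h _ →
              trans (eval-· h 0ℚ u) (ℚₚ.*-zeroˡ (eval h u))
          ; *ₗ-distribʳ = λ u c d → eval-sep λ h _ →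
              trans (eval-· h (c ℚ.+ d) u)
                (trans (ℚₚ.*-distribʳ-+ (eval h u) c d)
                  (trans (sym (cong₂ ℚ._+_ (eval-· h c u) (eval-· h d u)))
                    (sym (eval-++ h (c · u) (d · u)))))
          ; *ₗ-identityˡ = λ u → eval-sep λ h _ →
              trans (eval-· h 1ℚ u) (ℚₚ.*-identityˡ (eval h u))
          ; *ₗ-assoc = λ c d u → eval-sep λ h _ →
              trans (eval-· h (c ℚ.* d) u)
                (trans (ℚₚ.*-assoc c d (eval h u))
                  (sym (trans (eval-· h c (d · u)) (cong (c ℚ.*_) (eval-· h d u)))))
          ; *ₗ-zeroʳ = λ _ → mk≈ λ _ → refl
          ; *ₗ-distribˡ = λ c u v → eval-sep λ h _ →
              trans (eval-· h c (u ++ v))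
                (trans (cong (c ℚ.*_) (eval-++ h u v))
                  (trans (ℚₚ.*-distribˡ-+ c (eval h u) (eval h v))
                    (trans (sym (cong₂ ℚ._+_ (eval-· h c u) (eval-· h c v)))
                      (sym (eval-++ h (c · u) (c · v))))))
          }
        }
      ; -ᴹ‿cong = ·-cong {ℚ.- 1ℚ} refl
      ; -ᴹ‿inverse = (λ u → ≈-trans (++-comm (- u) u) (-‿inverseʳ u)) , -‿inverseʳ
      }
    }

bilinear : {A B C : Set} → (A → B → C) → List (ℚ × A) → List (ℚ × B) → List (ℚ × C)
bilinear f = cartesianProductWith (λ (c , a) (d , b) → c ℚ.* d , f a b)

module Bilinear (S T W : DecSetoid 0ℓ 0ℓ)
  (f : DecSetoid.Carrier S → DecSetoid.Carrier T → DecSetoid.Carrier W)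
  (f-cong : ∀ {a a′ b b′} → DecSetoid._≈_ S a a′ → DecSetoid._≈_ T b b′ →
            DecSetoid._≈_ W (f a b) (f a′ b′)) where
  private
    module S = DecSetoid S
    module T = DecSetoid T
    module FS = Free S
    module FT = Free T
    module FW = Free W
  open ≡-Reasoning

  inner : (DecSetoid.Carrier W → ℚ) → FT.Comb → DecSetoid.Carrier S → ℚ
  inner h v a = FT.eval (λ b → h (f a b)) v

  eval-bilinear : ∀ h u v → FW.eval h (bilinear f u v) ≡ FS.eval (inner h v) u
  eval-bilinear h []            v = refl
  eval-bilinear h ((c , a) ∷ u) v =
    trans (FW.eval-++ h (map (λ (d , b) → c ℚ.* d , f a b) v) (bilinear f u v))
      (cong₂ ℚ._+_ (row v) (eval-bilinear h u v))
    where
    row : ∀ v → FW.eval h (map (λ (d , b) → c ℚ.* d , f a b) v) ≡ c ℚ.* inner h v a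
    row []            = sym (ℚₚ.*-zeroʳ c)
    row ((d , b) ∷ v) =
      trans (cong₂ ℚ._+_ (ℚₚ.*-assoc c d (h (f a b))) (row v))
            (sym (ℚₚ.*-distribˡ-+ c _ _))

  inner-cong : ∀ h v → FW.Cong h → FS.Cong (inner h v)
  inner-cong h v hc a≈a′ = FT.eval-ext (λ b → hc (f-cong a≈a′ T.refl)) v

  bilinear-cong : ∀ {u u′ v v′} → u FS.≈ u′ → v FT.≈ v′ →
                  bilinear f u v FW.≈ bilinear f u′ v′
  bilinear-cong {u} {u′} {v} {v′} p q = FW.eval-sep λ h hc → begin
    FW.eval h (bilinear f u v)    ≡⟨ eval-bilinear h u v ⟩
    FS.eval (inner h v) u         ≡⟨ FS.eval-cong (inner-cong h v hc) p ⟩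
    FS.eval (inner h v) u′        ≡⟨ FS.eval-ext (λ a → FT.eval-cong (λ b≈b′ → hc (f-cong S.refl b≈b′)) q) u′ ⟩
    FS.eval (inner h v′) u′       ≡⟨ eval-bilinear h u′ v′ ⟨
    FW.eval h (bilinear f u′ v′)  ∎

  bilinear-distribʳ : ∀ v u u′ → bilinear f (u ++ u′) v FW.≈ bilinear f u v ++ bilinear f u′ v
  bilinear-distribʳ v u u′ = FW.eval-sep λ h _ → begin
    FW.eval h (bilinear f (u ++ u′) v)                             ≡⟨ eval-bilinear h (u ++ u′) v ⟩
    FS.eval (inner h v) (u ++ u′)                                  ≡⟨ FS.eval-++ _ u u′ ⟩
    FS.eval (inner h v) u ℚ.+ FS.eval (inner h v) u′               ≡⟨ cong₂ ℚ._+_ (eval-bilinear h u v) (eval-bilinear h u′ v) ⟨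
    FW.eval h (bilinear f u v) ℚ.+ FW.eval h (bilinear f u′ v)     ≡⟨ FW.eval-++ h (bilinear f u v) _ ⟨
    FW.eval h (bilinear f u v ++ bilinear f u′ v)                  ∎

  bilinear-distribˡ : ∀ u v v′ → bilinear f u (v ++ v′) FW.≈ bilinear f u v ++ bilinear f u v′
  bilinear-distribˡ u v v′ = FW.eval-sep λ h _ → begin
    FW.eval h (bilinear f u (v ++ v′))                             ≡⟨ eval-bilinear h u (v ++ v′) ⟩
    FS.eval (inner h (v ++ v′)) u                                  ≡⟨ FS.eval-ext (λ a → FT.eval-++ _ v v′) u ⟩
    FS.eval (λ a → inner h v a ℚ.+ inner h v′ a) u                 ≡⟨ FS.eval-+ _ _ u ⟩
    FS.eval (inner h v) u ℚ.+ FS.eval (inner h v′) u               ≡⟨ cong₂ ℚ._+_ (eval-bilinear h u v) (eval-bilinear h u v′) ⟨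
    FW.eval h (bilinear f u v) ℚ.+ FW.eval h (bilinear f u v′)     ≡⟨ FW.eval-++ h (bilinear f u v) _ ⟨
    FW.eval h (bilinear f u v ++ bilinear f u v′)                  ∎

  bilinear-·ˡ : ∀ c u v → bilinear f (c FS.· u) v FW.≈ c FW.· bilinear f u v
  bilinear-·ˡ c u v = FW.eval-sep λ h _ → begin
    FW.eval h (bilinear f (c FS.· u) v)     ≡⟨ eval-bilinear h (c FS.· u) v ⟩
    FS.eval (inner h v) (c FS.· u)          ≡⟨ FS.eval-· _ c u ⟩
    c ℚ.* FS.eval (inner h v) u             ≡⟨ cong (c ℚ.*_) (eval-bilinear h u v) ⟨
    c ℚ.* FW.eval h (bilinear f u v)        ≡⟨ FW.eval-· h c (bilinear f u v) ⟨
    FW.eval h (c FW.· bilinear f u v)       ∎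

  bilinear-·ʳ : ∀ c u v → bilinear f u (c FT.· v) FW.≈ c FW.· bilinear f u v
  bilinear-·ʳ c u v = FW.eval-sep λ h _ → begin
    FW.eval h (bilinear f u (c FT.· v))     ≡⟨ eval-bilinear h u (c FT.· v) ⟩
    FS.eval (inner h (c FT.· v)) u          ≡⟨ FS.eval-ext (λ a → FT.eval-· _ c v) u ⟩
    FS.eval (λ a → c ℚ.* inner h v a) u     ≡⟨ FS.eval-* c (inner h v) u ⟩
    c ℚ.* FS.eval (inner h v) u             ≡⟨ cong (c ℚ.*_) (eval-bilinear h u v) ⟨
    c ℚ.* FW.eval h (bilinear f u v)        ≡⟨ FW.eval-· h c (bilinear f u v) ⟨
    FW.eval h (c FW.· bilinear f u v)       ∎

  bilinear-zeroʳ : ∀ u → bilinear f u [] FW.≈ []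
  bilinear-zeroʳ u = FW.eval-sep λ h _ → trans (eval-bilinear h u []) (FS.eval-0 u)

module GroupAlgebra (G : Group 0ℓ 0ℓ)
                    (_≟ᴳ_ : Decidable (Group._≈_ G)) where
  private
    module G = Group G

  decSetoid : DecSetoid 0ℓ 0ℓ
  decSetoid = record
    { isDecEquivalence = record { isEquivalence = G.isEquivalence ; _≟_ = _≟ᴳ_ } }

  open Free decSetoid public
  open Bilinear decSetoid decSetoid decSetoid G._∙_ G.∙-cong
  private
    module V = LeftModule freeModule

  record GSet : Set₁ where
    field
      points : DecSetoid 0ℓ 0ℓ
    private
      module X = DecSetoid points
    infixr 7 _▷_
    field
      _▷_    : G.Carrier → X.Carrier → X.Carrier
      ▷-cong : ∀ {g h x y} → g G.≈ h → x X.≈ y → (g ▷ x) X.≈ (h ▷ y)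
      ▷-ε    : ∀ x → (G.ε ▷ x) X.≈ x
      ▷-∙    : ∀ g h x → ((g G.∙ h) ▷ x) X.≈ (g ▷ (h ▷ x))

  module LinearAction (Ω : GSet) where
    open GSet Ω renaming (points to X)
    private
      module M  = Free X
      module A  = Bilinear decSetoid X X _▷_ ▷-cong
    open ≡-Reasoning

    _▶_ : Comb → M.Comb → M.Comb
    _▶_ = bilinear _▷_

    ▶-assoc : ∀ u v m → (bilinear G._∙_ u v ▶ m) M.≈ (u ▶ (v ▶ m))
    ▶-assoc u v m = M.eval-sep λ h hc → begin
      M.eval h (bilinear G._∙_ u v ▶ m)
        ≡⟨ A.eval-bilinear h (bilinear G._∙_ u v) m ⟩
      eval (A.inner h m) (bilinear G._∙_ u v)
        ≡⟨ eval-bilinear (A.inner h m) u v ⟩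
      eval (λ a → eval (λ b → M.eval (λ x → h ((a G.∙ b) ▷ x)) m) v) u
        ≡⟨ eval-ext (λ a → eval-ext (λ b → M.eval-ext (λ x → hc (▷-∙ a b x)) m) v) u ⟩
      eval (λ a → eval (λ b → M.eval (λ x → h (a ▷ (b ▷ x))) m) v) u
        ≡⟨ eval-ext (λ a → A.eval-bilinear (λ x → h (a ▷ x)) v m) u ⟨
      eval (A.inner h (v ▶ m)) u
        ≡⟨ A.eval-bilinear h u (v ▶ m) ⟨
      M.eval h (u ▶ (v ▶ m)) ∎

    ▶-identityˡ : ∀ m → (((1ℚ , G.ε) ∷ []) ▶ m) M.≈ m
    ▶-identityˡ m = M.eval-sep λ h hc → begin
      M.eval h (((1ℚ , G.ε) ∷ []) ▶ m)               ≡⟨ A.eval-bilinear h ((1ℚ , G.ε) ∷ []) m ⟩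
      1ℚ ℚ.* A.inner h m G.ε ℚ.+ 0ℚ                  ≡⟨ ℚₚ.+-identityʳ _ ⟩
      1ℚ ℚ.* A.inner h m G.ε                         ≡⟨ ℚₚ.*-identityˡ _ ⟩
      A.inner h m G.ε                                ≡⟨ M.eval-ext (λ x → hc (▷-ε x)) m ⟩
      M.eval h m                                     ∎

  private
    regular : GSet
    regular = record
      { points = decSetoid
      ; _▷_ = G._∙_
      ; ▷-cong = G.∙-cong
      ; ▷-ε = G.identityˡ
      ; ▷-∙ = G.assoc
      }

    module Regular = LinearAction regular

    identityʳ : ∀ u → bilinear G._∙_ u ((1ℚ , G.ε) ∷ []) ≈ u
    identityʳ u = eval-sep λ h hc → trans (eval-bilinear h u ((1ℚ , G.ε) ∷ []))
      (eval-ext (λ a → trans (ℚₚ.+-identityʳ _)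
        (trans (ℚₚ.*-identityˡ _) (hc (G.identityʳ a)))) u)

  groupAlgebra : ℚ-Algebra
  groupAlgebra = record
    { ring = record
      { Carrier = Comb
      ; _≈_ = _≈_
      ; _+_ = _++_
      ; _*_ = bilinear G._∙_
      ; -_  = -_
      ; 0#  = []
      ; 1#  = (1ℚ , G.ε) ∷ []
      ; isRing = record
        { +-isAbelianGroup = V.+ᴹ-isAbelianGroup
        ; *-cong = bilinear-cong
        ; *-assoc = Regular.▶-assoc
        ; *-identity = Regular.▶-identityˡ , identityʳ
        ; distrib = bilinear-distribˡ , bilinear-distribʳ
        }
      }
    ; _·_ = _·_
    ; isLeftModule = V.isLeftModule
    ; ·-*-assoc = bilinear-·ˡ
    ; *-·-comm = λ c x y → bilinear-·ʳ c x y
    }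

  -- The module over ℚG with basis the points of a G-set.
  module PermutationModule (Ω : GSet) where
    open GSet Ω renaming (points to X)
    private
      module M = Free X
      module MV = LeftModule M.freeModule
      module A = Bilinear decSetoid X X _▷_ ▷-cong
    open LinearAction Ω

    permutationModule : LeftModule (ℚ-Algebra.ring groupAlgebra) 0ℓ 0ℓ
    permutationModule = record
      { Carrierᴹ = M.Comb
      ; _≈ᴹ_ = M._≈_
      ; _+ᴹ_ = _++_
      ; _*ₗ_ = bilinear _▷_
      ; 0ᴹ = []
      ; -ᴹ_ = M.-_
      ; isLeftModule = record
        { isLeftSemimodule = record
          { +ᴹ-isCommutativeMonoid = MV.+ᴹ-isCommutativeMonoid
          ; isPreleftSemimodule = record
            { *ₗ-cong = A.bilinear-cong
            ; *ₗ-zeroˡ = λ _ → M.mk≈ λ _ → refl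
            ; *ₗ-distribʳ = A.bilinear-distribʳ
            ; *ₗ-identityˡ = ▶-identityˡ
            ; *ₗ-assoc = ▶-assoc
            ; *ₗ-zeroʳ = A.bilinear-zeroʳ
            ; *ₗ-distribˡ = A.bilinear-distribˡ
            }
          }
        ; -ᴹ‿cong = MV.-ᴹ‿cong
        ; -ᴹ‿inverse = MV.-ᴹ‿inverse
        }
      }

private
  variable
    n : ℕ

-- (σ ∙ τ)(i) = σ(τ(i)), whereas _∘ₚ_ composes in diagrammatic order.
𝔖 : ℕ → Group 0ℓ 0ℓ
𝔖 n = record
  { Carrier = Permutation′ n
  ; _≈_ = Perm._≈_
  ; _∙_ = λ σ τ → τ Perm.∘ₚ σ
  ; ε = Perm.id
  ; _⁻¹ = Perm.flip
  ; isGroup = record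
    { isMonoid = record
      { isSemigroup = record
        { isMagma = record
          { isEquivalence = record
            { refl = λ _ → refl
            ; sym = λ p i → sym (p i)
            ; trans = λ p q i → trans (p i) (q i)
            }
          ; ∙-cong = λ {σ} {σ′} {τ} {τ′} p q i →
              trans (cong (σ ⟨$⟩ʳ_) (q i)) (p (τ′ ⟨$⟩ʳ i))
          }
        ; assoc = λ _ _ _ _ → refl
        }
      ; identity = (λ _ _ → refl) , (λ _ _ → refl)
      }
    ; inverse = (λ σ i → Perm.inverseˡ σ) , (λ σ i → Perm.inverseʳ σ)
    ; ⁻¹-cong = λ {σ} {τ} p i → begin
        σ ⟨$⟩ˡ i                        ≡⟨ cong (σ ⟨$⟩ˡ_) (Perm.inverseʳ τ) ⟨
        σ ⟨$⟩ˡ (τ ⟨$⟩ʳ (τ ⟨$⟩ˡ i))      ≡⟨ cong (σ ⟨$⟩ˡ_) (p (τ ⟨$⟩ˡ i)) ⟨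
        σ ⟨$⟩ˡ (σ ⟨$⟩ʳ (τ ⟨$⟩ˡ i))      ≡⟨ Perm.inverseˡ σ ⟩
        τ ⟨$⟩ˡ i                        ∎
    }
  }
  where open ≡-Reasoning

_≟ᵖ_ : Decidable (Group._≈_ (𝔖 n))
σ ≟ᵖ τ = Finₚ.all? λ i → (σ ⟨$⟩ʳ i) Finₚ.≟ (τ ⟨$⟩ʳ i)

ℚ𝔖 : ℕ → ℚ-Algebra
ℚ𝔖 n = GroupAlgebra.groupAlgebra (𝔖 n) _≟ᵖ_

ℚ𝔖-ring : ℕ → Ring 0ℓ 0ℓ
ℚ𝔖-ring n = ℚ-Algebra.ring (ℚ𝔖 n)

-- The permutation of {0,1,2} with one-line word v, extended by the
-- identity; w is the one-line word of the inverse.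
oneLine : (v w : Vec (Fin 3) 3)
          {vw : True (Finₚ.all? λ i → lookup v (lookup w i) Finₚ.≟ i)}
          {wv : True (Finₚ.all? λ i → lookup w (lookup v i) Finₚ.≟ i)} →
          ∀ {m} → Permutation′ (3 ℕ.+ m)
oneLine v w {vw} {wv} =
  ↔-sym +↔⊎ ↔-∘ ((π ⊎-↔ ↔-id _) ↔-∘ +↔⊎)
  where
  π : Permutation′ 3
  π = permutation (lookup v) (lookup w) (toWitness vw) (toWitness wv)

E₁₂₃ : 3 ℕ.≤ n → ℚ-Algebra.Carrier (ℚ𝔖 n)
E₁₂₃ (s≤s (s≤s (s≤s z≤n))) =
  (      1ℚ , oneLine (0F ∷ 1F ∷ 2F ∷ []) (0F ∷ 1F ∷ 2F ∷ [])) ∷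
  (ℚ.-   1ℚ , oneLine (0F ∷ 2F ∷ 1F ∷ []) (0F ∷ 2F ∷ 1F ∷ [])) ∷
  (ℚ.-   1ℚ , oneLine (1F ∷ 0F ∷ 2F ∷ []) (1F ∷ 0F ∷ 2F ∷ [])) ∷
  (      1ℚ , oneLine (1F ∷ 2F ∷ 0F ∷ []) (2F ∷ 0F ∷ 1F ∷ [])) ∷
  (      1ℚ , oneLine (2F ∷ 0F ∷ 1F ∷ []) (1F ∷ 2F ∷ 0F ∷ [])) ∷
  (ℚ.-   1ℚ , oneLine (2F ∷ 1F ∷ 0F ∷ []) (2F ∷ 1F ∷ 0F ∷ [])) ∷ []

-- Indices start at 0: simple i exchanges the positions i and i + 1.
simple : Fin (pred n) → Permutation′ n
simple {suc n} i = transpose (inject₁ i) (Fin.suc i)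

module _ (n : ℕ) where
  open ℚ-Algebra (ℚ𝔖 n) hiding (zero; refl; sym; trans)

  e : Fin (pred n) → Carrier
  e i = ½ · (1# - ((1ℚ , simple i) ∷ []))

  data TLRelator : Pred Carrier 0ℓ where
    relator : ∀ i j → toℕ j ≡ suc (toℕ i) ⊎ toℕ i ≡ suc (toℕ j) →
              TLRelator (e i * e j * e i - (1ℤ / 4) · e i)

  TL : ℚ-Algebra
  TL = ℚ𝔖 n /ᴬ ⟨ ring ⟩ TLRelator

-- Entry j is the pair of exponents of x_j and y_j.
Monomial : ℕ → Set
Monomial n = Vec (ℕ × ℕ) n

Bicomposition : ℕ → Set
Bicomposition k = Σ (Vec (ℕ × ℕ) k) (All (_≢ (0 , 0)))

-- Subsets are bit vectors, so recursion on i meets its elements in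
-- increasing order.
spread : (i : Subset n) → Vec (ℕ × ℕ) ∣ i ∣ → Monomial n
spread []            []      = []
spread (outside ∷ i) α       = (0 , 0) ∷ spread i α
spread (inside  ∷ i) (a ∷ α) = a ∷ spread i α

𝐱𝐲 : (i : Subset n) → Bicomposition ∣ i ∣ → Monomial n
𝐱𝐲 i (α , _) = spread i α

support : Monomial n → Subset n
support []                = []
support ((0 , 0) ∷ m)     = outside ∷ support m
support ((0 , suc _) ∷ m) = inside ∷ support m
support ((suc _ , _) ∷ m) = inside ∷ support m

exponents : (m : Monomial n) → Bicomposition ∣ support m ∣
exponents []                  = [] , []
exponents ((0 , 0) ∷ m)       = exponents m
exponents (a@(0 , suc _) ∷ m) = let α , nz = exponents m in a ∷ α , (λ ()) ∷ nz
exponents (a@(suc _ , _) ∷ m) = let α , nz = exponents m in a ∷ α , (λ ()) ∷ nz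

𝐱𝐲-exponents : (m : Monomial n) → 𝐱𝐲 (support m) (exponents m) ≡ m
𝐱𝐲-exponents []                = refl
𝐱𝐲-exponents ((0 , 0) ∷ m)     = cong ((0 , 0) ∷_) (𝐱𝐲-exponents m)
𝐱𝐲-exponents ((0 , suc _) ∷ m) = cong (_ ∷_) (𝐱𝐲-exponents m)
𝐱𝐲-exponents ((suc _ , _) ∷ m) = cong (_ ∷_) (𝐱𝐲-exponents m)

image : Permutation′ n → Subset n → Subset n
image σ i = tabulate λ j → lookup i (σ ⟨$⟩ˡ j)

∈-image : ∀ (σ : Permutation′ n) i {j} → j ∈ image σ i ⇔ (∃[ k ] k ∈ i × σ ⟨$⟩ʳ k ≡ j)
∈-image σ i {j} = mk⇔
  (λ j∈ → σ ⟨$⟩ˡ j ,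
    Vecₚ.lookup⇒[]= _ i
      (trans (sym (Vecₚ.lookup∘tabulate _ j)) (Vecₚ.[]=⇒lookup j∈)) ,
    Perm.inverseʳ σ)
  (λ { (k , k∈ , refl) → Vecₚ.lookup⇒[]= _ (image σ i)
    (trans (Vecₚ.lookup∘tabulate _ (σ ⟨$⟩ʳ k))
      (trans (cong (lookup i) (Perm.inverseˡ σ)) (Vecₚ.[]=⇒lookup k∈))) })

∣image∣ : ∀ (σ : Permutation′ n) i → ∣ image σ i ∣ ≡ ∣ i ∣
∣image∣ {n} σ i = begin
  ∣ image σ i ∣                               ≡⟨ ∣∣-sum (image σ i) ⟩
  sum (λ j → b (lookup (image σ i) j))        ≡⟨ sum-cong-≗ {n} (λ j → cong b (Vecₚ.lookup∘tabulate (λ k → lookup i (σ ⟨$⟩ˡ k)) j)) ⟩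
  sum (λ j → b (lookup i (σ ⟨$⟩ˡ j)))         ≡⟨ sum-permute (λ j → b (lookup i j)) (Perm.flip σ) ⟨
  sum (λ j → b (lookup i j))                  ≡⟨ ∣∣-sum i ⟨
  ∣ i ∣                                       ∎
  where
  open ≡-Reasoning
  open Sums ℕₚ.+-0-commutativeMonoid using (sum; sum-permute; sum-cong-≗)
  b : Bool → ℕ
  b true  = 1
  b false = 0
  ∣∣-sum : ∀ {n} (i : Subset n) → ∣ i ∣ ≡ sum (λ j → b (lookup i j))
  ∣∣-sum []            = refl
  ∣∣-sum (inside ∷ i)  = cong suc (∣∣-sum i)
  ∣∣-sum (outside ∷ i) = ∣∣-sum i

transfer : ∀ (σ : Permutation′ n) i → Bicomposition ∣ i ∣ → Bicomposition ∣ image σ i ∣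
transfer σ i = subst Bicomposition (sym (∣image∣ σ i))

-- Defined through the unique form 𝐱𝐲 i a of a monomial; ∗ᵐ-𝐱𝐲 below is
-- the characterising equation σ ∗ (𝐱𝐲)ᵢᵃ = (𝐱𝐲)_{σ·i}ᵃ.
infixr 7 _∗ᵐ_
_∗ᵐ_ : Permutation′ n → Monomial n → Monomial n
σ ∗ᵐ m = 𝐱𝐲 (image σ (support m)) (transfer σ (support m) (exponents m))

entries : ∀ {k} → Bicomposition k → List (ℕ × ℕ)
entries (α , _) = Vec.toList α

entries-subst : ∀ {k l} (eq : k ≡ l) a → entries (subst Bicomposition eq a) ≡ entries a
entries-subst refl a = refl

spreadᴸ : Subset n → List (ℕ × ℕ) → Monomial n
spreadᴸ []            _       = []
spreadᴸ (outside ∷ i) as      = (0 , 0) ∷ spreadᴸ i as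
spreadᴸ (inside ∷ i)  []      = (0 , 0) ∷ spreadᴸ i []
spreadᴸ (inside ∷ i)  (a ∷ as) = a ∷ spreadᴸ i as

𝐱𝐲-spreadᴸ : ∀ (i : Subset n) a → 𝐱𝐲 i a ≡ spreadᴸ i (entries a)
𝐱𝐲-spreadᴸ i (α , _) = go i α
  where
  go : ∀ {n} (i : Subset n) α → spread i α ≡ spreadᴸ i (Vec.toList α)
  go []            []      = refl
  go (outside ∷ i) α       = cong (_ ∷_) (go i α)
  go (inside ∷ i)  (a ∷ α) = cong (a ∷_) (go i α)

support-𝐱𝐲 : ∀ (i : Subset n) a → support (𝐱𝐲 i a) ≡ i
support-𝐱𝐲 []            ([] , [])                 = refl
support-𝐱𝐲 (outside ∷ i) a                         = cong (_ ∷_) (support-𝐱𝐲 i a)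
support-𝐱𝐲 (inside ∷ i)  ((0 , 0) ∷ _ , nz ∷ _)    = contradiction refl nz
support-𝐱𝐲 (inside ∷ i)  ((0 , suc _) ∷ α , _ ∷ p) = cong (_ ∷_) (support-𝐱𝐲 i (α , p))
support-𝐱𝐲 (inside ∷ i)  ((suc _ , _) ∷ α , _ ∷ p) = cong (_ ∷_) (support-𝐱𝐲 i (α , p))

entries-𝐱𝐲 : ∀ (i : Subset n) a → entries (exponents (𝐱𝐲 i a)) ≡ entries a
entries-𝐱𝐲 []            ([] , [])                 = refl
entries-𝐱𝐲 (outside ∷ i) a                         = entries-𝐱𝐲 i a
entries-𝐱𝐲 (inside ∷ i)  ((0 , 0) ∷ _ , nz ∷ _)    = contradiction refl nz
entries-𝐱𝐲 (inside ∷ i)  ((0 , suc _) ∷ α , _ ∷ p) = cong (_ ∷_) (entries-𝐱𝐲 i (α , p))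
entries-𝐱𝐲 (inside ∷ i)  ((suc _ , _) ∷ α , _ ∷ p) = cong (_ ∷_) (entries-𝐱𝐲 i (α , p))

∗ᵐ-spreadᴸ : ∀ (σ : Permutation′ n) m →
             σ ∗ᵐ m ≡ spreadᴸ (image σ (support m)) (entries (exponents m))
∗ᵐ-spreadᴸ σ m = trans (𝐱𝐲-spreadᴸ (image σ (support m)) (transfer σ (support m) (exponents m)))
  (cong (spreadᴸ (image σ (support m)))
    (entries-subst (sym (∣image∣ σ (support m))) (exponents m)))

∗ᵐ-𝐱𝐲 : ∀ (σ : Permutation′ n) i a →
        σ ∗ᵐ 𝐱𝐲 i a ≡ 𝐱𝐲 (image σ i) (transfer σ i a)
∗ᵐ-𝐱𝐲 σ i a = begin
  σ ∗ᵐ 𝐱𝐲 i a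
    ≡⟨ ∗ᵐ-spreadᴸ σ (𝐱𝐲 i a) ⟩
  spreadᴸ (image σ (support (𝐱𝐲 i a))) (entries (exponents (𝐱𝐲 i a)))
    ≡⟨ cong₂ (λ j → spreadᴸ (image σ j)) (support-𝐱𝐲 i a) (entries-𝐱𝐲 i a) ⟩
  spreadᴸ (image σ i) (entries a)
    ≡⟨ cong (spreadᴸ (image σ i)) (entries-subst (sym (∣image∣ σ i)) a) ⟨
  spreadᴸ (image σ i) (entries (transfer σ i a))
    ≡⟨ 𝐱𝐲-spreadᴸ (image σ i) (transfer σ i a) ⟨
  𝐱𝐲 (image σ i) (transfer σ i a) ∎
  where open ≡-Reasoning

∗ᵐ-cong : ∀ {σ τ : Permutation′ n} {m m′} → σ Perm.≈ τ → m ≡ m′ → σ ∗ᵐ m ≡ τ ∗ᵐ m′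
∗ᵐ-cong {σ = σ} {τ} {m} σ≈τ refl =
  trans (∗ᵐ-spreadᴸ σ m)
    (trans (cong (λ i → spreadᴸ i (entries (exponents m)))
      (Vecₚ.tabulate-cong λ j → cong (lookup (support m))
        (Group.⁻¹-cong (𝔖 _) {σ} {τ} σ≈τ j)))
      (sym (∗ᵐ-spreadᴸ τ m)))

∗ᵐ-id : ∀ (m : Monomial n) → Perm.id ∗ᵐ m ≡ m
∗ᵐ-id m = begin
  Perm.id ∗ᵐ m
    ≡⟨ ∗ᵐ-spreadᴸ Perm.id m ⟩
  spreadᴸ (image Perm.id (support m)) (entries (exponents m))
    ≡⟨ cong (λ i → spreadᴸ i (entries (exponents m))) (Vecₚ.tabulate∘lookup (support m)) ⟩
  spreadᴸ (support m) (entries (exponents m))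
    ≡⟨ 𝐱𝐲-spreadᴸ (support m) (exponents m) ⟨
  𝐱𝐲 (support m) (exponents m)
    ≡⟨ 𝐱𝐲-exponents m ⟩
  m ∎
  where open ≡-Reasoning

∗ᵐ-∙ : ∀ (σ τ : Permutation′ n) m → (τ Perm.∘ₚ σ) ∗ᵐ m ≡ σ ∗ᵐ τ ∗ᵐ m
∗ᵐ-∙ σ τ m = begin
  (τ Perm.∘ₚ σ) ∗ᵐ m
    ≡⟨ ∗ᵐ-spreadᴸ (τ Perm.∘ₚ σ) m ⟩
  spreadᴸ (image (τ Perm.∘ₚ σ) (support m)) (entries (exponents m))
    ≡⟨ cong₂ spreadᴸ
         (Vecₚ.tabulate-cong λ j → sym (Vecₚ.lookup∘tabulate _ (σ ⟨$⟩ˡ j)))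
         (sym (entries-subst (sym (∣image∣ τ (support m))) (exponents m))) ⟩
  spreadᴸ (image σ (image τ (support m))) (entries a)
    ≡⟨ cong (spreadᴸ (image σ (image τ (support m))))
         (entries-subst (sym (∣image∣ σ (image τ (support m)))) a) ⟨
  spreadᴸ (image σ (image τ (support m))) (entries (transfer σ (image τ (support m)) a))
    ≡⟨ 𝐱𝐲-spreadᴸ (image σ (image τ (support m))) (transfer σ (image τ (support m)) a) ⟨
  𝐱𝐲 (image σ (image τ (support m))) (transfer σ (image τ (support m)) a)
    ≡⟨ ∗ᵐ-𝐱𝐲 σ (image τ (support m)) a ⟨
  σ ∗ᵐ τ ∗ᵐ m ∎
  where
  open ≡-Reasoning
  a = transfer τ (support m) (exponents m)

monomials : ℕ → DecSetoid 0ℓ 0ℓ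
monomials n = ≡.decSetoid (Vecₚ.≡-dec {n = n} (≡-dec ℕₚ._≟_ ℕₚ._≟_))

module _ (n : ℕ) where
  open GroupAlgebra (𝔖 n) _≟ᵖ_

  hivert : GSet
  hivert = record
    { points = monomials n
    ; _▷_ = _∗ᵐ_
    ; ▷-cong = λ {σ} {τ} → ∗ᵐ-cong {σ = σ} {τ}
    ; ▷-ε = ∗ᵐ-id
    ; ▷-∙ = ∗ᵐ-∙
    }

  -- ℚ[x₁,…,xₙ,y₁,…,yₙ] as the ℚ-vector space with basis the monomials
  -- (products of polynomials play no role), on which ℚ𝔖ₙ acts by
  -- the bilinear extension of σ ∗ᵐ m.
  polynomials : LeftModule (ℚ𝔖-ring n) 0ℓ 0ℓ
  polynomials = PermutationModule.permutationModule hivert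

Ker : (n : ℕ) → TwoSidedIdeal (ℚ𝔖-ring n)
Ker n = Annihilator (ℚ𝔖-ring n) (polynomials n)

{-# OPTIONS --safe #-}
module Submission where

-- A permutation moves only the support of a monomial, keeping the list of its
-- exponents.  So an element of the group algebra acts as zero exactly when it acts
-- as zero on the vector space spanned by the subsets of the positions.
--
-- For permutations s and t let alt s t = 1 - t - s + st + ts - sts.  Applied to
-- the transpositions (a b) and (b c) it is the antisymmetrizer of the three
-- positions a, b, c.
-- * E is the antisymmetrizer of the first three positions.  Two of any three
--   positions are both inside or both outside a given subset, so the six terms
--   cancel in pairs and E acts as zero (E₁₂₃-in-kernel).
-- * All antisymmetrizers are conjugate (alt-conjugate, extend-triple), so the
--   ideal of E contains every one of them (alt∈⟨E⟩).
-- * With e = (1 - s) / 2 and f = (1 - t) / 2, the element e f e - e / 4 is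
--   alt s t / 8 (relator-alt).  Hence the Temperley-Lieb relators lie in the
--   ideal of E, and E is 8 times one of them.
--
-- It remains to see that the kernel lies in every ideal J inside the kernel that
-- contains the antisymmetrizers (Ker-least).  The disorder of a permutation σ is
-- the sum of i (n - σ(i)) over the positions i; exchanging the values of σ at an
-- inversion lowers it (disorder-transpose).  Let u be in the kernel, with all its
-- terms of disorder at most N, and consider the terms σ of disorder N.
-- * If σ has values a > b > c at positions i < j < k, then σ alt (i j) (j k) is σ
--   plus terms obtained from σ by undoing inversions.  So modulo J the term σ can
--   be replaced by terms of smaller disorder (reduce-321).
-- * If σ avoids 321, let I be the set of positions whose value is exceeded by an
--   earlier value.  Then σ is increasing on I and on its complement, and it is the
--   only such permutation carrying I to σI.  From any other permutation carrying
--   I to σI one reaches σ by undoing inversions, so that permutation has larger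
--   disorder (avoiding-minimal).
-- Hence u is congruent modulo J to an element v + w of the kernel, where the terms
-- of v have disorder less than N and those of w have disorder N and avoid 321.
-- For σ in w, the coefficient of σI in (v + w) applied to I is the coefficient of
-- σ in w; so w = 0 (avoiding-vanishes), and induction on N applies to v.

open import Algebra.Bundles using (Group; Ring)
open import Algebra.Module.Bundles using (LeftModule)
open import Algebra.Module.Structures using (IsLeftModule)
import Algebra.Properties.AbelianGroup as AbelianGroupProperties
import Algebra.Properties.CommutativeMonoid.Sum as Sums
import Algebra.Properties.CommutativeSemigroup as CommutativeSemigroupProperties
import Algebra.Properties.Group as GroupProperties
import Algebra.Properties.Ring as RingProperties
open import Data.Bool.Base using (Bool; true; false; if_then_else_)
import Data.Bool.Properties as Boolₚ
open import Data.Fin.Base as Fin using (Fin; toℕ; inject₁; punchIn; punchOut)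
open import Data.Fin.Induction using (<-wellFounded)
open import Data.Fin.Patterns using (0F; 1F; 2F)
open import Data.Fin.Permutation as Perm using (Permutation′; _⟨$⟩ʳ_; _⟨$⟩ˡ_; transpose)
open import Data.Fin.Properties as Finₚ using (_≟_; any?)
open import Data.Fin.Subset using (Subset; ∣_∣)
import Data.Integer.Base as ℤ
open import Data.List.Base using ([]; _∷_; _++_)
open import Data.List.Relation.Binary.Pointwise.Base using (Pointwise; []; _∷_)
open import Data.List.Relation.Unary.All as All using (All; []; _∷_)
open import Data.List.Relation.Unary.All.Properties using (++⁺; ¬Any⇒All¬)
import Data.List.Relation.Unary.Any as Any
open import Data.Nat.Base as ℕ using (ℕ; _≤_; _<_; zero; suc; pred; s≤s; z≤n)
import Data.Nat.Induction as ℕᵢ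
import Data.Nat.Properties as ℕₚ
open import Data.Nat.Tactic.RingSolver using (solve-∀)
open import Data.Product.Base using (_×_; _,_; Σ-syntax; ∃; proj₂)
open import Data.Rational.Base as ℚ using (ℚ; 0ℚ; 1ℚ; _/_)
import Data.Rational.Properties as ℚₚ
open import Data.Rational.Solver using (module +-*-Solver)
open import Data.Sum.Base using (_⊎_; inj₁; inj₂; [_,_])
open import Data.Vec.Base using ([]; _∷_; lookup; tabulate)
import Data.Vec.Properties as Vecₚ
open import Data.Vec.Relation.Unary.All using ([]; _∷_)
open import Function.Base using (id; _∘_)
open import Function.Bundles using (Injection; mk⇔)
open import Function.Properties.Inverse using (↔⇒↣)
open import Induction.WellFounded using (Acc; acc)
open import Level using (0ℓ)
open import Relation.Binary.Definitions using (DecidableEquality; tri<; tri≈; tri>)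
open import Relation.Binary.PropositionalEquality hiding ([_])
open import Relation.Nullary using (¬_; Dec; yes; no; contradiction; does; _×-dec_)
open import Relation.Nullary.Decidable using (dec-false; does-⇔)
open import Relation.Unary using (_⊆_; _≐_; ｛_｝)
open import Defs

open TwoSidedIdeal using (member)

private
  variable
    n : ℕ

-- Transpositions

⟨$⟩ʳ-injective : ∀ (σ : Permutation′ n) {i j} → σ ⟨$⟩ʳ i ≡ σ ⟨$⟩ʳ j → i ≡ j
⟨$⟩ʳ-injective σ = Injection.injective (↔⇒↣ σ)

transpose-left : ∀ (a b : Fin n) → transpose a b ⟨$⟩ʳ a ≡ b
transpose-left a b with a ≟ a
... | yes _   = refl
... | no  a≢a = contradiction refl a≢a

transpose-right : ∀ (a b : Fin n) → transpose a b ⟨$⟩ʳ b ≡ a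
transpose-right a b with b ≟ a
... | yes b≡a = b≡a
... | no  _ with b ≟ b
...   | yes _   = refl
...   | no  b≢b = contradiction refl b≢b

transpose-other : ∀ {a b x : Fin n} → x ≢ a → x ≢ b → transpose a b ⟨$⟩ʳ x ≡ x
transpose-other {a = a} {b} {x} x≢a x≢b with x ≟ a
... | yes x≡a = contradiction x≡a x≢a
... | no  _ with x ≟ b
...   | yes x≡b = contradiction x≡b x≢b
...   | no  _   = refl

transpose-involutive : ∀ (a b x : Fin n) →
  transpose a b ⟨$⟩ʳ (transpose a b ⟨$⟩ʳ x) ≡ x
transpose-involutive a b x with x ≟ a
... | yes refl = transpose-right a b
... | no  x≢a with x ≟ b
...   | yes refl = transpose-left a b
...   | no  x≢b = transpose-other x≢a x≢b

transpose-conjugate : ∀ (σ : Permutation′ n) a b x →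
  transpose (σ ⟨$⟩ʳ a) (σ ⟨$⟩ʳ b) ⟨$⟩ʳ (σ ⟨$⟩ʳ x) ≡ σ ⟨$⟩ʳ (transpose a b ⟨$⟩ʳ x)
transpose-conjugate σ a b x with x ≟ a
... | yes refl = transpose-left (σ ⟨$⟩ʳ a) (σ ⟨$⟩ʳ b)
... | no  x≢a with x ≟ b
...   | yes refl = transpose-right (σ ⟨$⟩ʳ a) (σ ⟨$⟩ʳ b)
...   | no  x≢b = transpose-other (x≢a ∘ ⟨$⟩ʳ-injective σ) (x≢b ∘ ⟨$⟩ʳ-injective σ)

transpose-sym : ∀ (a b x : Fin n) → transpose a b ⟨$⟩ʳ x ≡ transpose b a ⟨$⟩ʳ x
transpose-sym a b x = by-cases (x ≟ a) (x ≟ b)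
  where
  by-cases : Dec (x ≡ a) → Dec (x ≡ b) → transpose a b ⟨$⟩ʳ x ≡ transpose b a ⟨$⟩ʳ x
  by-cases (yes refl) _          = trans (transpose-left a b) (sym (transpose-right b a))
  by-cases (no  _)    (yes refl) = trans (transpose-right a b) (sym (transpose-left b a))
  by-cases (no  x≢a)  (no  x≢b)  = trans (transpose-other x≢a x≢b) (sym (transpose-other x≢b x≢a))

-- Any injection of three positions extends to a permutation.
extend-triple : ∀ {p q r a b c : Fin n} →
  p ≢ q → p ≢ r → q ≢ r → a ≢ b → a ≢ c → b ≢ c →
  Σ[ σ ∈ Permutation′ n ] (σ ⟨$⟩ʳ p ≡ a × σ ⟨$⟩ʳ q ≡ b × σ ⟨$⟩ʳ r ≡ c)
extend-triple {p = p} {q} {r} {a} {b} {c} p≢q p≢r q≢r a≢b a≢c b≢c =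
  τ₁ Perm.∘ₚ τ₂ Perm.∘ₚ τ₃ ,
  trans (cong (τ₃ ⟨$⟩ʳ_) p↦a) (transpose-other (p≢r ∘ ⟨$⟩ʳ-injective (τ₁ Perm.∘ₚ τ₂) ∘ trans p↦a) a≢c) ,
  trans (cong (τ₃ ⟨$⟩ʳ_) q↦b) (transpose-other (q≢r ∘ ⟨$⟩ʳ-injective (τ₁ Perm.∘ₚ τ₂) ∘ trans q↦b) b≢c) ,
  transpose-left (τ₂ ⟨$⟩ʳ (τ₁ ⟨$⟩ʳ r)) c
  where
  τ₁ = transpose p a
  τ₂ = transpose (τ₁ ⟨$⟩ʳ q) b
  τ₃ = transpose (τ₂ ⟨$⟩ʳ (τ₁ ⟨$⟩ʳ r)) c
  p↦a : τ₂ ⟨$⟩ʳ (τ₁ ⟨$⟩ʳ p) ≡ a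
  p↦a = trans (cong (τ₂ ⟨$⟩ʳ_) (transpose-left p a))
    (transpose-other (λ a≡τ₁q → p≢q (⟨$⟩ʳ-injective τ₁ (trans (transpose-left p a) a≡τ₁q))) a≢b)
  q↦b : τ₂ ⟨$⟩ʳ (τ₁ ⟨$⟩ʳ q) ≡ b
  q↦b = transpose-left (τ₁ ⟨$⟩ʳ q) b

-- The disorder of a permutation

private
  module ∑ = Sums ℕₚ.+-0-commutativeMonoid

sum-exchange : ∀ {n} (f g : Fin n → ℕ) {i j} → i ≢ j →
  (∀ k → k ≢ i → k ≢ j → f k ≡ g k) → f i ℕ.+ f j ℕ.< g i ℕ.+ g j →
  ∑.sum f ℕ.< ∑.sum g
sum-exchange {suc zero} f g {Fin.zero} {Fin.zero} i≢j _ _ = contradiction refl i≢j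
sum-exchange {suc (suc n)} f g {i} {j} i≢j f≡g f<g = begin-strict
  ∑.sum f                       ≡⟨ split f ⟩
  f i ℕ.+ f j ℕ.+ rest f        ≡⟨ cong (f i ℕ.+ f j ℕ.+_) rest≡ ⟩
  f i ℕ.+ f j ℕ.+ rest g        <⟨ ℕₚ.+-monoˡ-< (rest g) f<g ⟩
  g i ℕ.+ g j ℕ.+ rest g        ≡⟨ split g ⟨
  ∑.sum g                       ∎
  where
  open ℕₚ.≤-Reasoning
  j′ : Fin (suc n)
  j′ = punchOut i≢j
  rest : (Fin (suc (suc n)) → ℕ) → ℕ
  rest h = ∑.sum (λ k → h (punchIn i (punchIn j′ k)))
  split : ∀ h → ∑.sum h ≡ h i ℕ.+ h j ℕ.+ rest h
  split h = begin-equality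
    ∑.sum h                                               ≡⟨ ∑.sum-remove {i = i} h ⟩
    h i ℕ.+ ∑.sum (λ k → h (punchIn i k))                 ≡⟨ cong (h i ℕ.+_) (∑.sum-remove {i = j′} (h ∘ punchIn i)) ⟩
    h i ℕ.+ (h (punchIn i j′) ℕ.+ rest h)                 ≡⟨ cong (λ k → h i ℕ.+ (h k ℕ.+ rest h)) (Finₚ.punchIn-punchOut i≢j) ⟩
    h i ℕ.+ (h j ℕ.+ rest h)                              ≡⟨ ℕₚ.+-assoc (h i) _ _ ⟨
    h i ℕ.+ h j ℕ.+ rest h                                ∎
  rest≡ : rest f ≡ rest g
  rest≡ = ∑.sum-cong-≗ λ k → f≡g _ (Finₚ.punchInᵢ≢i i _) λ eq →
    Finₚ.punchInᵢ≢i j′ k (Finₚ.punchIn-injective i _ _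
      (trans eq (sym (Finₚ.punchIn-punchOut i≢j))))

rearrangement : ∀ {x y a b} → x < y → a < b → x ℕ.* b ℕ.+ y ℕ.* a < x ℕ.* a ℕ.+ y ℕ.* b
rearrangement {x} {y} {a} {b} x<y a<b with ℕₚ.m≤n⇒∃[o]m+o≡n x<y | ℕₚ.m≤n⇒∃[o]m+o≡n a<b
... | d , refl | e , refl =
  ℕₚ.≤-trans (ℕₚ.m≤m+n _ (d ℕ.+ e ℕ.+ d ℕ.* e)) (ℕₚ.≤-reflexive (lemma x d a e))
  where
  lemma : ∀ x d a e →
    suc (x ℕ.* (suc a ℕ.+ e) ℕ.+ (suc x ℕ.+ d) ℕ.* a) ℕ.+ (d ℕ.+ e ℕ.+ d ℕ.* e)
      ≡ x ℕ.* a ℕ.+ (suc x ℕ.+ d) ℕ.* (suc a ℕ.+ e)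
  lemma = solve-∀

-- The sum of i (n - σ(i)).  It plays the role of the number of inversions: all
-- that matters is that it is a natural number and that undoing an inversion
-- lowers it.  The subtraction never truncates, as positions and values run from
-- 0 to n - 1.
disorder : Permutation′ n → ℕ
disorder {n} σ = ∑.sum λ i → toℕ i ℕ.* (n ℕ.∸ toℕ (σ ⟨$⟩ʳ i))

disorder-cong : ∀ {σ τ : Permutation′ n} → σ Perm.≈ τ → disorder σ ≡ disorder τ
disorder-cong {n} σ≈τ = ∑.sum-cong-≗ λ i → cong (λ k → toℕ i ℕ.* (n ℕ.∸ toℕ k)) (σ≈τ i)

-- In one-line notation, the word of transpose i j ∘ₚ σ is that of σ with the
-- values at the positions i and j exchanged.
disorder-transpose : ∀ (σ : Permutation′ n) {i j} → i Fin.< j → σ ⟨$⟩ʳ j Fin.< σ ⟨$⟩ʳ i →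
  disorder (transpose i j Perm.∘ₚ σ) < disorder σ
disorder-transpose {n} σ {i} {j} i<j σj<σi =
  sum-exchange _ _ (Finₚ.<⇒≢ i<j)
    (λ k k≢i k≢j → cong (λ l → term k (σ ⟨$⟩ʳ l)) (transpose-other k≢i k≢j))
    (subst₂ (λ k l → term i (σ ⟨$⟩ʳ k) ℕ.+ term j (σ ⟨$⟩ʳ l) < term i (σ ⟨$⟩ʳ i) ℕ.+ term j (σ ⟨$⟩ʳ j))
      (sym (transpose-left i j)) (sym (transpose-right i j))
      (rearrangement i<j (ℕₚ.∸-monoʳ-< σj<σi (Finₚ.toℕ≤n (σ ⟨$⟩ʳ i)))))
  where
  term : Fin n → Fin n → ℕ
  term k l = toℕ k ℕ.* (n ℕ.∸ toℕ l)

-- Permutations increasing on both colours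

-- σ maps positions of each colour to values of that colour, where c colours the
-- positions and d the values.
Colours : (c d : Fin n → Bool) → Permutation′ n → Set
Colours c d σ = ∀ i → d (σ ⟨$⟩ʳ i) ≡ c i

-- σ is increasing on each colour of positions.
Sorted : (Fin n → Bool) → Permutation′ n → Set
Sorted c σ = ∀ {i j} → i Fin.< j → c i ≡ c j → σ ⟨$⟩ʳ i Fin.< σ ⟨$⟩ʳ j

module _ {c d : Fin n → Bool} where

  -- The value τ(i) is also σ(k) for a position k of the colour of i.  If k < i,
  -- then τ already takes this value at k; if k > i, then σ(i) < σ(k) = τ(i).
  sorted-step : ∀ (σ τ : Permutation′ n) → Colours c d σ → Colours c d τ → Sorted c σ →
    ∀ {i} → (∀ {k} → k Fin.< i → σ ⟨$⟩ʳ k ≡ τ ⟨$⟩ʳ k) → ¬ (τ ⟨$⟩ʳ i Fin.< σ ⟨$⟩ʳ i)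
  sorted-step σ τ cσ cτ sσ {i} agree τi<σi with Finₚ.<-cmp (σ ⟨$⟩ˡ (τ ⟨$⟩ʳ i)) i
  ... | tri< k<i _ _ = Finₚ.<⇒≢ k<i (⟨$⟩ʳ-injective τ (trans (sym (agree k<i)) (Perm.inverseʳ σ)))
  ... | tri≈ _ k≡i _ = Finₚ.<⇒≢ τi<σi (trans (sym (Perm.inverseʳ σ)) (cong (σ ⟨$⟩ʳ_) k≡i))
  ... | tri> _ _ i<k = Finₚ.<-asym τi<σi
    (subst (σ ⟨$⟩ʳ i Fin.<_) (Perm.inverseʳ σ) (sσ i<k same))
    where
    same : c i ≡ c (σ ⟨$⟩ˡ (τ ⟨$⟩ʳ i))
    same = trans (sym (cτ i)) (trans (cong d (sym (Perm.inverseʳ σ))) (cσ _))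

  sorted-unique : ∀ (σ τ : Permutation′ n) → Colours c d σ → Colours c d τ →
    Sorted c σ → Sorted c τ → σ Perm.≈ τ
  sorted-unique σ τ cσ cτ sσ sτ i = go (<-wellFounded i)
    where
    go : ∀ {i} → Acc Fin._<_ i → σ ⟨$⟩ʳ i ≡ τ ⟨$⟩ʳ i
    go {i} (acc rs) with Finₚ.<-cmp (σ ⟨$⟩ʳ i) (τ ⟨$⟩ʳ i)
    ... | tri< σi<τi _ _ = contradiction σi<τi (sorted-step τ σ cτ cσ sτ (λ k<i → sym (go (rs k<i))))
    ... | tri≈ _ σi≡τi _ = σi≡τi
    ... | tri> _ _ τi<σi = contradiction τi<σi (sorted-step σ τ cσ cτ sσ (λ k<i → go (rs k<i)))

  -- Undoing inversions within the colours leads from τ to a sorted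
  -- permutation, which is σ.
  sorted-minimal : ∀ (σ : Permutation′ n) → Colours c d σ → Sorted c σ →
    ∀ τ → Colours c d τ → τ Perm.≈ σ ⊎ disorder σ < disorder τ
  sorted-minimal σ cσ sσ τ cτ = go τ cτ (ℕᵢ.<-wellFounded (disorder τ))
    where
    inversion? : ∀ τ → Dec (∃ λ i → ∃ λ j → i Fin.< j × c i ≡ c j × τ ⟨$⟩ʳ j Fin.< τ ⟨$⟩ʳ i)
    inversion? τ = any? λ i → any? λ j →
      i Finₚ.<? j ×-dec c i Boolₚ.≟ c j ×-dec (τ ⟨$⟩ʳ j) Finₚ.<? (τ ⟨$⟩ʳ i)
    go : ∀ τ → Colours c d τ → Acc _<_ (disorder τ) → τ Perm.≈ σ ⊎ disorder σ < disorder τ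
    go τ cτ (acc rs) with inversion? τ
    ... | no none = inj₁ (sorted-unique τ σ cτ cσ sτ sσ)
      where
      sτ : Sorted c τ
      sτ {i} {j} i<j ci≡cj with Finₚ.<-cmp (τ ⟨$⟩ʳ i) (τ ⟨$⟩ʳ j)
      ... | tri< τi<τj _ _ = τi<τj
      ... | tri≈ _ τi≡τj _ = contradiction (⟨$⟩ʳ-injective τ τi≡τj) (Finₚ.<⇒≢ i<j)
      ... | tri> _ _ τj<τi = contradiction (i , j , i<j , ci≡cj , τj<τi) none
    ... | yes (i , j , i<j , ci≡cj , τj<τi)
        with go τ′ cτ′ (rs τ′<τ)
      where
      τ′ = transpose i j Perm.∘ₚ τ
      τ′<τ : disorder τ′ < disorder τ
      τ′<τ = disorder-transpose τ i<j τj<τi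
      cτ′ : Colours c d τ′
      cτ′ k with k ≟ i
      ... | yes refl = trans (cτ j) (sym ci≡cj)
      ... | no  _ with k ≟ j
      ...   | yes refl = trans (cτ i) ci≡cj
      ...   | no  _    = cτ k
    ...   | inj₁ τ′≈σ = inj₂ (subst (_< disorder τ) (disorder-cong {σ = transpose i j Perm.∘ₚ τ} {σ} τ′≈σ)
                          (disorder-transpose τ i<j τj<τi))
    ...   | inj₂ σ<τ′ = inj₂ (ℕₚ.<-trans σ<τ′ (disorder-transpose τ i<j τj<τi))

-- Permutations avoiding the pattern 321

-- Three positions at which σ is decreasing.
Contains321 : Permutation′ n → Set
Contains321 {n} σ = ∃ λ (i : Fin n) → ∃ λ j → ∃ λ k →
  i Fin.< j × j Fin.< k × σ ⟨$⟩ʳ j Fin.< σ ⟨$⟩ʳ i × σ ⟨$⟩ʳ k Fin.< σ ⟨$⟩ʳ j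

contains321? : ∀ (σ : Permutation′ n) → Dec (Contains321 σ)
contains321? σ = any? λ i → any? λ j → any? λ k →
  i Finₚ.<? j ×-dec j Finₚ.<? k
    ×-dec (σ ⟨$⟩ʳ j) Finₚ.<? (σ ⟨$⟩ʳ i) ×-dec (σ ⟨$⟩ʳ k) Finₚ.<? (σ ⟨$⟩ʳ j)

exceeded? : ∀ (σ : Permutation′ n) i → Dec (∃ λ j → j Fin.< i × σ ⟨$⟩ʳ i Fin.< σ ⟨$⟩ʳ j)
exceeded? σ i = any? λ j → j Finₚ.<? i ×-dec (σ ⟨$⟩ʳ i) Finₚ.<? (σ ⟨$⟩ʳ j)

-- The positions that are not left-to-right maxima of σ.
exceeded : Permutation′ n → Subset n
exceeded σ = tabulate λ i → does (exceeded? σ i)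

-- If σ(i) > σ(j) for two positions i < j, then j is exceeded; and if i is
-- exceeded too, by the value at k < i, then k, i, j carry a pattern 321.
avoiding-sorted : ∀ {σ : Permutation′ n} → ¬ Contains321 σ → Sorted (lookup (exceeded σ)) σ
avoiding-sorted {σ = σ} avoids {i} {j} i<j ci≡cj with Finₚ.<-cmp (σ ⟨$⟩ʳ i) (σ ⟨$⟩ʳ j)
... | tri< σi<σj _ _ = σi<σj
... | tri≈ _ σi≡σj _ = contradiction (⟨$⟩ʳ-injective σ σi≡σj) (Finₚ.<⇒≢ i<j)
... | tri> _ _ σj<σi
  with exceeded? σ i | exceeded? σ j
     | trans (sym (Vecₚ.lookup∘tabulate (does ∘ exceeded? σ) i)) (trans ci≡cj (Vecₚ.lookup∘tabulate (does ∘ exceeded? σ) j))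
...   | yes (k , k<i , σi<σk) | _ | _ = contradiction (k , i , j , k<i , i<j , σi<σk , σj<σi) avoids
...   | no _ | yes _ | ()
...   | no _ | no ¬exc | _ = contradiction (i , i<j , σj<σi) ¬exc

image-colours : ∀ (τ : Permutation′ n) I {J} → image τ I ≡ J → Colours (lookup I) (lookup J) τ
image-colours τ I refl i =
  trans (Vecₚ.lookup∘tabulate _ (τ ⟨$⟩ʳ i)) (cong (lookup I) (Perm.inverseˡ τ))

avoiding-minimal : ∀ {σ : Permutation′ n} → ¬ Contains321 σ →
  ∀ τ → image τ (exceeded σ) ≡ image σ (exceeded σ) →
  τ Perm.≈ σ ⊎ disorder σ < disorder τ
avoiding-minimal {σ = σ} avoids τ τI≡σI =
  sorted-minimal {d = lookup (image σ (exceeded σ))} σ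
    (image-colours σ (exceeded σ) refl) (avoiding-sorted {σ = σ} avoids)
    τ (image-colours τ (exceeded σ) τI≡σI)

-- Antisymmetrizers in the group algebra

module _ {n : ℕ} where

  open GroupAlgebra (𝔖 n) _≟ᵖ_
    using (Comb; eval; Cong; eval-sep; eval-ext; eval-+; eval-*; eval-0; _·_)
    renaming (_≈_ to infix 4 _≈_)
  open Group (𝔖 n) using () renaming (_∙_ to infixr 7 _∙_)
  open Ring (ℚ𝔖-ring n) using () renaming (_*_ to infixl 7 _⊛_; _-_ to infixl 6 _⊖_)

  same-terms : ∀ {u v : Comb} →
    Pointwise (λ (c , σ) (d , τ) → c ≡ d × σ Perm.≈ τ) u v → u ≈ v
  same-terms p = eval-sep λ h hc → go h hc p
    where
    go : ∀ h → Cong h → ∀ {u v} →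
         Pointwise (λ (c , σ) (d , τ) → c ≡ d × σ Perm.≈ τ) u v → eval h u ≡ eval h v
    go h hc []                       = refl
    go h hc {(_ , σ) ∷ _} {(_ , τ) ∷ _} ((c≡d , σ≈τ) ∷ p) =
      cong₂ ℚ._+_ (cong₂ ℚ._*_ c≡d (hc {σ} {τ} σ≈τ)) (go h hc p)

  -- The basis element of the group algebra given by σ.
  single : Permutation′ n → Comb
  single σ = (1ℚ , σ) ∷ []

  -- If s and t are the transpositions (a b) and (b c), the alternating sum of
  -- the permutations of the positions a, b, c.
  alt : (s t : Permutation′ n) → Comb
  alt s t = (1ℚ , Perm.id) ∷ (ℚ.- 1ℚ , t) ∷ (ℚ.- 1ℚ , s)
          ∷ (1ℚ , s ∙ t) ∷ (1ℚ , t ∙ s) ∷ (ℚ.- 1ℚ , s ∙ t ∙ s) ∷ []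

  alt-cong : ∀ {s s′ t t′} → s Perm.≈ s′ → t Perm.≈ t′ → alt s t ≈ alt s′ t′
  alt-cong {s} {s′} {t} {t′} p q = same-terms
    ( (refl , λ _ → refl)
    ∷ (refl , q)
    ∷ (refl , p)
    ∷ (refl , λ x → trans (cong (s ⟨$⟩ʳ_) (q x)) (p (t′ ⟨$⟩ʳ x)))
    ∷ (refl , λ x → trans (cong (t ⟨$⟩ʳ_) (p x)) (q (s′ ⟨$⟩ʳ x)))
    ∷ (refl , λ x → trans (cong (λ y → s ⟨$⟩ʳ (t ⟨$⟩ʳ y)) (p x))
                (trans (cong (s ⟨$⟩ʳ_) (q (s′ ⟨$⟩ʳ x))) (p (t′ ⟨$⟩ʳ (s′ ⟨$⟩ʳ x)))))
    ∷ [])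

  alt-conjugate : ∀ g {s s′ t t′} →
    (∀ x → g ⟨$⟩ʳ (s ⟨$⟩ʳ x) ≡ s′ ⟨$⟩ʳ (g ⟨$⟩ʳ x)) →
    (∀ x → g ⟨$⟩ʳ (t ⟨$⟩ʳ x) ≡ t′ ⟨$⟩ʳ (g ⟨$⟩ʳ x)) →
    single g ⊛ alt s t ⊛ single (Perm.flip g) ≈ alt s′ t′
  alt-conjugate g {s} {s′} {t} {t′} gs gt = same-terms
    ( (refl , λ x → g⁻¹ x)
    ∷ (refl , λ x → conj t t′ gt (g⁻¹ x))
    ∷ (refl , λ x → conj s s′ gs (g⁻¹ x))
    ∷ (refl , λ x → conj s s′ gs (conj t t′ gt (g⁻¹ x)))
    ∷ (refl , λ x → conj t t′ gt (conj s s′ gs (g⁻¹ x)))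
    ∷ (refl , λ x → conj s s′ gs (conj t t′ gt (conj s s′ gs (g⁻¹ x))))
    ∷ [])
    where
    g⁻¹ : ∀ x → g ⟨$⟩ʳ (g ⟨$⟩ˡ x) ≡ x
    g⁻¹ x = Perm.inverseʳ g
    conj : ∀ (r r′ : Permutation′ n) → (∀ x → g ⟨$⟩ʳ (r ⟨$⟩ʳ x) ≡ r′ ⟨$⟩ʳ (g ⟨$⟩ʳ x)) →
           ∀ {y z} → g ⟨$⟩ʳ y ≡ z → g ⟨$⟩ʳ (r ⟨$⟩ʳ y) ≡ r′ ⟨$⟩ʳ z
    conj r r′ gr {y} gy≡z = trans (gr y) (cong (r′ ⟨$⟩ʳ_) gy≡z)

  -- Besides s s = 1 nothing about s and t is used.  The left side has ten terms,
  -- each with coefficient 1/8 up to sign: eight from (1 - s)(1 - t)(1 - s) and two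
  -- from 1 - s.
  relator-alt : ∀ i j →
    e n i ⊛ e n j ⊛ e n i ⊖ (ℤ.1ℤ / 4) · e n i ≈ (ℤ.1ℤ / 8) · alt (simple {n} i) (simple {n} j)
  relator-alt i j = eval-sep λ h hc →
    trans
      (cong (λ a → ½³ ℚ.* h Perm.id ℚ.+ (-½³ ℚ.* h s ℚ.+ (-½³ ℚ.* h t ℚ.+ (½³ ℚ.* h (t ∙ s)
         ℚ.+ (-½³ ℚ.* h s ℚ.+ (½³ ℚ.* a ℚ.+ (½³ ℚ.* h (s ∙ t) ℚ.+ (-½³ ℚ.* h (s ∙ t ∙ s)
         ℚ.+ (-½³ ℚ.* h Perm.id ℚ.+ (½³ ℚ.* h s ℚ.+ 0ℚ))))))))))
        (hc {s ∙ s} {Perm.id} s²))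
      (solve 6 (λ a b c d f g → con ½³ :* a :+ (con -½³ :* b :+ (con -½³ :* c :+ (con ½³ :* f
         :+ (con -½³ :* b :+ (con ½³ :* a :+ (con ½³ :* d :+ (con -½³ :* g
         :+ (con -½³ :* a :+ (con ½³ :* b :+ con 0ℚ))))))))) :=
         con ½³ :* a :+ (con -½³ :* c :+ (con -½³ :* b :+ (con ½³ :* d
         :+ (con ½³ :* f :+ (con -½³ :* g :+ con 0ℚ)))))) refl
        (h Perm.id) (h s) (h t) (h (s ∙ t)) (h (t ∙ s)) (h (s ∙ t ∙ s)))
    where
    open +-*-Solver
    s = simple {n} i
    t = simple {n} j
    ½³ = ℤ.1ℤ / 8
    -½³ = ℤ.-1ℤ / 8
    s² : ∀ x → s ⟨$⟩ʳ (s ⟨$⟩ʳ x) ≡ x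
    s² = simple-involutive i
      where
      simple-involutive : ∀ {n} (i : Fin (pred n)) x → simple {n} i ⟨$⟩ʳ (simple {n} i ⟨$⟩ʳ x) ≡ x
      simple-involutive {suc n} i = transpose-involutive (inject₁ i) (Fin.suc i)

  -- The kernel of the action

  private
    module M = Free (monomials n)
    module Act = Bilinear (GroupAlgebra.decSetoid (𝔖 n) _≟ᵖ_) (monomials n) (monomials n)
      _∗ᵐ_ (λ {σ} {τ} → ∗ᵐ-cong {σ = σ} {τ})

  -- By linearity it suffices to look at single monomials x, and at the
  -- coefficients through functionals h.
  kernel-intro : ∀ u → (∀ x h → eval (λ σ → h (σ ∗ᵐ x)) u ≡ 0ℚ) → member (Ker n) u
  kernel-intro u zeros m = M.eval-sep λ h _ → trans (Act.eval-bilinear h u m) (terms h m)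
    where
    open ≡-Reasoning
    terms : ∀ h m → eval (Act.inner h m) u ≡ 0ℚ
    terms h []            = eval-0 u
    terms h ((c , x) ∷ m) = begin
      eval (λ σ → c ℚ.* h (σ ∗ᵐ x) ℚ.+ Act.inner h m σ) u
        ≡⟨ eval-+ (λ σ → c ℚ.* h (σ ∗ᵐ x)) (Act.inner h m) u ⟩
      eval (λ σ → c ℚ.* h (σ ∗ᵐ x)) u ℚ.+ eval (Act.inner h m) u
        ≡⟨ cong₂ ℚ._+_ (trans (eval-* c (λ σ → h (σ ∗ᵐ x)) u) (cong (c ℚ.*_) (zeros x h))) (terms h m) ⟩
      c ℚ.* 0ℚ ℚ.+ 0ℚ
        ≡⟨ trans (ℚₚ.+-identityʳ _) (ℚₚ.*-zeroʳ c) ⟩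
      0ℚ ∎

  kernel-elim : ∀ u → member (Ker n) u → ∀ x h → eval (λ σ → h (σ ∗ᵐ x)) u ≡ 0ℚ
  kernel-elim u k x h = begin
    eval (λ σ → h (σ ∗ᵐ x)) u                    ≡⟨ eval-ext (λ σ → trans (ℚₚ.+-identityʳ _) (ℚₚ.*-identityˡ _)) u ⟨
    eval (Act.inner h ((1ℚ , x) ∷ [])) u         ≡⟨ Act.eval-bilinear h u ((1ℚ , x) ∷ []) ⟨
    M.eval h (bilinear _∗ᵐ_ u ((1ℚ , x) ∷ []))   ≡⟨ M.eval-cong (cong h) (k ((1ℚ , x) ∷ [])) ⟩
    0ℚ                                           ∎
    where open ≡-Reasoning

-- Two of the three arguments coincide, so the terms cancel in pairs.
alternating-sum : ∀ (F : Bool → Bool → Bool → ℚ) a b c →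
  1ℚ ℚ.* F a b c ℚ.+ (ℚ.- 1ℚ ℚ.* F a c b ℚ.+ (ℚ.- 1ℚ ℚ.* F b a c ℚ.+
    (1ℚ ℚ.* F c a b ℚ.+ (1ℚ ℚ.* F b c a ℚ.+ (ℚ.- 1ℚ ℚ.* F c b a ℚ.+ 0ℚ))))) ≡ 0ℚ
alternating-sum F a b c = cases a b c
  where
  open +-*-Solver
  𝟙 -𝟙 𝟘 : ∀ {k} → Polynomial k
  𝟙  = con 1ℚ
  -𝟙 = con (ℚ.- 1ℚ)
  𝟘  = con 0ℚ
  aac : ∀ p q r → 1ℚ ℚ.* p ℚ.+ (ℚ.- 1ℚ ℚ.* q ℚ.+ (ℚ.- 1ℚ ℚ.* p ℚ.+
    (1ℚ ℚ.* r ℚ.+ (1ℚ ℚ.* q ℚ.+ (ℚ.- 1ℚ ℚ.* r ℚ.+ 0ℚ))))) ≡ 0ℚ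
  aac = solve 3 (λ p q r → 𝟙 :* p :+ (-𝟙 :* q :+ (-𝟙 :* p :+
    (𝟙 :* r :+ (𝟙 :* q :+ (-𝟙 :* r :+ 𝟘))))) := 𝟘) refl
  abb : ∀ p q r → 1ℚ ℚ.* p ℚ.+ (ℚ.- 1ℚ ℚ.* p ℚ.+ (ℚ.- 1ℚ ℚ.* q ℚ.+
    (1ℚ ℚ.* q ℚ.+ (1ℚ ℚ.* r ℚ.+ (ℚ.- 1ℚ ℚ.* r ℚ.+ 0ℚ))))) ≡ 0ℚ
  abb = solve 3 (λ p q r → 𝟙 :* p :+ (-𝟙 :* p :+ (-𝟙 :* q :+
    (𝟙 :* q :+ (𝟙 :* r :+ (-𝟙 :* r :+ 𝟘))))) := 𝟘) refl
  aba : ∀ p q r → 1ℚ ℚ.* p ℚ.+ (ℚ.- 1ℚ ℚ.* q ℚ.+ (ℚ.- 1ℚ ℚ.* r ℚ.+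
    (1ℚ ℚ.* q ℚ.+ (1ℚ ℚ.* r ℚ.+ (ℚ.- 1ℚ ℚ.* p ℚ.+ 0ℚ))))) ≡ 0ℚ
  aba = solve 3 (λ p q r → 𝟙 :* p :+ (-𝟙 :* q :+ (-𝟙 :* r :+
    (𝟙 :* q :+ (𝟙 :* r :+ (-𝟙 :* p :+ 𝟘))))) := 𝟘) refl
  cases : ∀ a b c → 1ℚ ℚ.* F a b c ℚ.+ (ℚ.- 1ℚ ℚ.* F a c b ℚ.+ (ℚ.- 1ℚ ℚ.* F b a c ℚ.+
    (1ℚ ℚ.* F c a b ℚ.+ (1ℚ ℚ.* F b c a ℚ.+ (ℚ.- 1ℚ ℚ.* F c b a ℚ.+ 0ℚ))))) ≡ 0ℚ
  cases true  true  c     = aac (F true true c) (F true c true) (F c true true)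
  cases false false c     = aac (F false false c) (F false c false) (F c false false)
  cases true  false false = abb (F true false false) (F false true false) (F false false true)
  cases false true  true  = abb (F false true true) (F true false true) (F true true false)
  cases true  false true  = aba (F true false true) (F true true false) (F false true true)
  cases false true  false = aba (F false true false) (F false false true) (F true false false)

E₁₂₃-in-kernel : ∀ {n} (3≤n : 3 ≤ n) → member (Ker n) (E₁₂₃ 3≤n)
E₁₂₃-in-kernel {n} 3≤n@(s≤s (s≤s (s≤s z≤n))) = kernel-intro (E₁₂₃ 3≤n) λ x h →
  trans (eval-ext (λ σ → cong h (∗ᵐ-spreadᴸ σ x)) (E₁₂₃ 3≤n))
    (on-subsets (support x) λ K → h (spreadᴸ K (entries (exponents x))))
  where
  open GroupAlgebra (𝔖 n) _≟ᵖ_ using (eval; eval-ext)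
  -- The six permutations rearrange the first three bits of the subset.
  on-subsets : ∀ I (f : Subset n → ℚ) → eval (λ σ → f (image σ I)) (E₁₂₃ 3≤n) ≡ 0ℚ
  on-subsets (a ∷ b ∷ c ∷ I) f =
    trans (cong (λ I′ → let F = λ a b c → f (a ∷ b ∷ c ∷ I′) in
             1ℚ ℚ.* F a b c ℚ.+ (ℚ.- 1ℚ ℚ.* F a c b ℚ.+ (ℚ.- 1ℚ ℚ.* F b a c ℚ.+
             (1ℚ ℚ.* F c a b ℚ.+ (1ℚ ℚ.* F b c a ℚ.+ (ℚ.- 1ℚ ℚ.* F c b a ℚ.+ 0ℚ))))))
            (Vecₚ.tabulate∘lookup I))
      (alternating-sum (λ a b c → f (a ∷ b ∷ c ∷ I)) a b c)

module _ {n : ℕ} where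

  open GroupAlgebra (𝔖 n) _≟ᵖ_
    using (Comb; eval; coeff; δ; coeff-eval; mk≈; eval-ext; eval-0; eval-++)
    renaming (_≈_ to infix 4 _≈_)
  open Group (𝔖 n) using () renaming (_∙_ to infixr 7 _∙_)
  private
    module R = Ring (ℚ𝔖-ring n)
  open R using (1#) renaming (_*_ to infixl 7 _⊛_; _-_ to infixl 6 _⊖_)
  open GroupProperties R.+-group using (//-rightDividesˡ)
  open RingProperties (ℚ𝔖-ring n) using (-‿involutive)
  open CommutativeSemigroupProperties R.+-commutativeSemigroup using (x∙yz≈y∙xz)

  eval-cong-All : ∀ {g h} {u : Comb} → All (λ (_ , σ) → g σ ≡ h σ) u → eval g u ≡ eval h u
  eval-cong-All []                        = refl
  eval-cong-All {u = (c , _) ∷ _} (g≡h ∷ p) =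
    cong₂ (λ a b → c ℚ.* a ℚ.+ b) g≡h (eval-cong-All p)

  _≟ˢ_ : DecidableEquality (Subset n)
  _≟ˢ_ = Vecₚ.≡-dec Boolₚ._≟_

  image-cong : ∀ σ τ I → σ Perm.≈ τ → image σ I ≡ image τ I
  image-cong σ τ I σ≈τ =
    Vecₚ.tabulate-cong λ j → cong (lookup I) (Group.⁻¹-cong (𝔖 n) {σ} {τ} σ≈τ j)

  -- The functional σ ↦ [σI = J], a matrix entry of the action on subsets.
  same-image : Subset n → Subset n → Permutation′ n → ℚ
  same-image I J σ = if does (image σ I ≟ˢ J) then 1ℚ else 0ℚ

  -- Each of the k entries is (1 , 0).
  ones : ∀ k → Bicomposition k
  ones zero    = [] , []
  ones (suc k) = let α , nz = ones k in (1 , 0) ∷ α , (λ ()) ∷ nz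

  -- The product of the x_i with i in I.
  subset-monomial : Subset n → Monomial n
  subset-monomial I = 𝐱𝐲 I (ones ∣ I ∣)

  kernel-same-image : ∀ u → member (Ker n) u → ∀ I J → eval (same-image I J) u ≡ 0ℚ
  kernel-same-image u k I J = trans
    (eval-ext (λ σ → cong (λ K → if does (K ≟ˢ J) then 1ℚ else 0ℚ) (sym (support-image σ))) u)
    (kernel-elim u k (subset-monomial I)
      λ y → if does (support y ≟ˢ J) then 1ℚ else 0ℚ)
    where
    m = subset-monomial I
    support-image : ∀ σ → support (σ ∗ᵐ subset-monomial I) ≡ image σ I
    support-image σ = trans (support-𝐱𝐲 (image σ (support m)) (transfer σ (support m) (exponents m)))
      (cong (image σ) (support-𝐱𝐲 I (ones ∣ I ∣)))

  -- All terms have disorder less than N.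
  DisorderBelow : ℕ → Comb → Set
  DisorderBelow N = All λ (_ , σ) → disorder σ < N

  -- All terms have disorder N and avoid 321.
  AvoidingOfDisorder : ℕ → Comb → Set
  AvoidingOfDisorder N = All λ (_ , σ) → disorder σ ≡ N × ¬ Contains321 σ

  -- For a term σ of w let I be the exceeded positions of σ.  Among the terms of
  -- v and w only σ carries I to σI, so the coefficient of σI in the image of I
  -- is the coefficient of σ.
  avoiding-vanishes : ∀ {N} v w → DisorderBelow N v → AvoidingOfDisorder N w →
    member (Ker n) (v ++ w) → w ≈ []
  avoiding-vanishes {N} v w below avoiding k = mk≈ coeff≡0
    where
    at-term : ∀ σ → disorder σ ≡ N × ¬ Contains321 σ → eval (δ σ) w ≡ 0ℚ
    at-term σ (refl , avoids) = begin
      eval (δ σ) w                            ≡⟨ ℚₚ.+-identityˡ _ ⟨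
      0ℚ ℚ.+ eval (δ σ) w                     ≡⟨ cong₂ ℚ._+_ on-v on-w ⟨
      eval χ v ℚ.+ eval χ w                   ≡⟨ eval-++ χ v w ⟨
      eval χ (v ++ w)                         ≡⟨ kernel-same-image (v ++ w) k I (image σ I) ⟩
      0ℚ                                      ∎
      where
      open ≡-Reasoning
      I = exceeded σ
      χ = same-image I (image σ I)
      -- No term of v carries I to σI, and at most one term of w up to equality.
      χ≡0 : ∀ τ → disorder τ < disorder σ → χ τ ≡ 0ℚ
      χ≡0 τ τ<σ = cong (if_then 1ℚ else 0ℚ) (dec-false (image τ I ≟ˢ image σ I) λ τI≡σI →
        [ (λ τ≈σ → ℕₚ.<-irrefl (disorder-cong {σ = τ} {σ} τ≈σ) τ<σ)
        , ℕₚ.<-asym τ<σ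
        ] (avoiding-minimal {σ = σ} avoids τ τI≡σI))
      χ≡δ : ∀ τ → disorder τ ≡ disorder σ × ¬ Contains321 τ → χ τ ≡ δ σ τ
      χ≡δ τ (τ=σ , _) = cong (if_then 1ℚ else 0ℚ)
        (does-⇔ (mk⇔ forth (image-cong τ σ I)) (image τ I ≟ˢ image σ I) (τ ≟ᵖ σ))
        where
        forth : image τ I ≡ image σ I → τ Perm.≈ σ
        forth τI≡σI =
          [ id , (λ σ<τ → contradiction σ<τ (ℕₚ.<-irrefl (sym τ=σ))) ]
            (avoiding-minimal {σ = σ} avoids τ τI≡σI)
      on-v : eval χ v ≡ 0ℚ
      on-v = trans (eval-cong-All (All.map (λ {(_ , τ)} → χ≡0 τ) below)) (eval-0 v)
      on-w : eval χ w ≡ eval (δ σ) w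
      on-w = eval-cong-All (All.map (λ {(_ , τ)} → χ≡δ τ) avoiding)

    coeff≡0 : ∀ ρ → coeff w ρ ≡ 0ℚ
    coeff≡0 ρ with Any.any? (λ (_ , σ) → σ ≟ᵖ ρ) w
    ... | no absent = trans (coeff-eval w ρ)
      (trans (eval-cong-All (All.map (λ {(_ , σ)} → δ≡0 σ) (¬Any⇒All¬ w absent))) (eval-0 w))
      where
      δ≡0 : ∀ σ → ¬ (σ Perm.≈ ρ) → δ ρ σ ≡ 0ℚ
      δ≡0 σ σ≉ρ = cong (if_then 1ℚ else 0ℚ) (dec-false (σ ≟ᵖ ρ) σ≉ρ)
    ... | yes present with Any.lookup present | All.lookupAny avoiding present
    ...   | _ , σ | good , σ≈ρ = begin
      coeff w ρ         ≡⟨ coeff-cong w {σ} {ρ} σ≈ρ ⟨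
      coeff w σ         ≡⟨ coeff-eval w σ ⟩
      eval (δ σ) w      ≡⟨ at-term σ good ⟩
      0ℚ                ∎
      where
      open ≡-Reasoning
      coeff-cong : ∀ u {σ ρ} → σ Perm.≈ ρ → coeff u σ ≡ coeff u ρ
      coeff-cong []            σ≈ρ = refl
      coeff-cong ((c , τ) ∷ u) {σ} {ρ} σ≈ρ = cong₂ (λ b → (if b then c else 0ℚ) ℚ.+_)
        (does-⇔ (mk⇔ (λ p i → trans (p i) (σ≈ρ i)) (λ p i → trans (p i) (sym (σ≈ρ i)))) (τ ≟ᵖ σ) (τ ≟ᵖ ρ))
        (coeff-cong u {σ} {ρ} σ≈ρ)

  -- Straightening modulo an ideal

  ~-member : (I : TwoSidedIdeal (ℚ𝔖-ring n)) → let open Quotient (ℚ𝔖 n) I in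
    ∀ {x y} → x ~ y → member I y → member I x
  ~-member I {x} {y} x~y y∈I = TwoSidedIdeal.resp I (//-rightDividesˡ y x) (TwoSidedIdeal.+-closed I x~y y∈I)

  module _ (I : TwoSidedIdeal (ℚ𝔖-ring n))
           (alt∈I : ∀ {a b c : Fin n} → a ≢ b → a ≢ c → b ≢ c →
                    member I (alt (transpose a b) (transpose b c)))
           (I⊆Ker : member I ⊆ member (Ker n)) where

    open Quotient (ℚ𝔖 n) I

    -- Since alt s t is in I, the term τ is congruent to minus its product with
    -- the other five terms of alt s t.
    reduce-321 : ∀ c τ → Contains321 τ →
      Σ[ v ∈ Comb ] DisorderBelow (disorder τ) v × ((c , τ) ∷ []) ~ v
    reduce-321 c τ (i , j , k , i<j , j<k , τj<τi , τk<τj) = R.- (x ⊛ lower) ,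
      t< ∷ s< ∷ st< ∷ ts< ∷ sts< ∷ [] ,
      TwoSidedIdeal.resp I x-alt
        (TwoSidedIdeal.*-closedˡ I x (alt∈I i≢j i≢k j≢k))
      where
      s = transpose i j
      t = transpose j k
      x = (c , τ) ∷ []
      -- alt s t without its leading term 1
      lower : Comb
      lower = (ℚ.- 1ℚ , t) ∷ (ℚ.- 1ℚ , s) ∷ (1ℚ , s ∙ t) ∷ (1ℚ , t ∙ s)
            ∷ (ℚ.- 1ℚ , s ∙ t ∙ s) ∷ []
      x-alt : x ⊛ alt s t ≈ x ⊖ (R.- (x ⊛ lower))
      x-alt = begin
        x ⊛ (1# R.+ lower)             ≈⟨ R.distribˡ x 1# lower ⟩
        x ⊛ 1# R.+ x ⊛ lower           ≈⟨ R.+-cong (R.*-identityʳ x) (R.sym (-‿involutive (x ⊛ lower))) ⟩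
        x ⊖ (R.- (x ⊛ lower))          ∎
        where open import Relation.Binary.Reasoning.Setoid R.setoid
      i≢j = Finₚ.<⇒≢ i<j
      j≢k = Finₚ.<⇒≢ j<k
      i≢k = Finₚ.<⇒≢ (Finₚ.<-trans i<j j<k)
      si : s ⟨$⟩ʳ i ≡ j
      si = transpose-left i j
      sj : s ⟨$⟩ʳ j ≡ i
      sj = transpose-right i j
      sk : s ⟨$⟩ʳ k ≡ k
      sk = transpose-other (≢-sym i≢k) (≢-sym j≢k)
      ti : t ⟨$⟩ʳ i ≡ i
      ti = transpose-other i≢j i≢k
      tj : t ⟨$⟩ʳ j ≡ k
      tj = transpose-left j k
      at : ∀ {p q p′ q′} → p ≡ p′ → q ≡ q′ → τ ⟨$⟩ʳ p′ Fin.< τ ⟨$⟩ʳ q′ → τ ⟨$⟩ʳ p Fin.< τ ⟨$⟩ʳ q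
      at refl refl lt = lt
      τk<τi = Finₚ.<-trans τk<τj τj<τi
      -- With values a > b > c of τ at i < j < k, the words of τ s, τ t, τ s t,
      -- τ t s and τ s t s have b a c, a c b, b c a, c a b and c b a there; each
      -- arises from an earlier one, or from τ, by undoing one inversion.
      s< : disorder (τ ∙ s) < disorder τ
      s< = disorder-transpose τ i<j τj<τi
      t< : disorder (τ ∙ t) < disorder τ
      t< = disorder-transpose τ j<k τk<τj
      st< : disorder (τ ∙ s ∙ t) < disorder τ
      st< = ℕₚ.<-trans (disorder-transpose (τ ∙ s) j<k (at sk sj τk<τi)) s<
      ts< : disorder (τ ∙ t ∙ s) < disorder τ
      ts< = ℕₚ.<-trans (disorder-transpose (τ ∙ t) i<j (at tj ti τk<τi)) t<
      sts< : disorder (τ ∙ s ∙ t ∙ s) < disorder τ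
      sts< = ℕₚ.<-trans (disorder-transpose (τ ∙ s ∙ t) i<j
        (at (trans (cong (s ⟨$⟩ʳ_) tj) sk) (trans (cong (s ⟨$⟩ʳ_) ti) si) τk<τj)) st<

    -- u is congruent to a combination whose terms have disorder less than N, or
    -- have disorder N and avoid 321.
    Straightened : ℕ → Comb → Set
    Straightened N u =
      Σ[ v ∈ Comb ] Σ[ w ∈ Comb ] DisorderBelow N v × AvoidingOfDisorder N w × u ~ v ++ w

    straighten-∷ : ∀ N c τ u → disorder τ < suc N → Straightened N u → Straightened N ((c , τ) ∷ u)
    straighten-∷ N c τ u τ≤N (v , w , v<N , w∈ , u~vw) =
      [ below , (λ τ≡N → at-N τ≡N (contains321? τ)) ] (ℕₚ.m≤n⇒m<n∨m≡n (ℕ.s≤s⁻¹ τ≤N))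
      where
      x = (c , τ) ∷ []
      x~ : ∀ r → x ~ r → x ++ u ~ r ++ (v ++ w)
      x~ r x~r = +-~ {x} {r} {u} {v ++ w} x~r u~vw
      x~x : x ~ x
      x~x = ≈⇒~ {x} {x} R.refl
      below : disorder τ < N → Straightened N ((c , τ) ∷ u)
      below τ<N = x ++ v , w , τ<N ∷ v<N , w∈ , x~ x x~x
      at-N : disorder τ ≡ N → Dec (Contains321 τ) → Straightened N ((c , τ) ∷ u)
      at-N τ≡N (no avoids)  = v , x ++ w , v<N , (τ≡N , avoids) ∷ w∈ ,
        ~-trans {x ++ u} {x ++ (v ++ w)} {v ++ (x ++ w)} (x~ x x~x)
          (≈⇒~ {x ++ (v ++ w)} {v ++ (x ++ w)} (x∙yz≈y∙xz x v w))
      at-N τ≡N (yes has321) = let r , r<τ , x~r = reduce-321 c τ has321 in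
        r ++ v , w , ++⁺ (subst (λ k → DisorderBelow k r) τ≡N r<τ) v<N , w∈ ,
        ~-trans {x ++ u} {r ++ (v ++ w)} {(r ++ v) ++ w} (x~ r x~r)
          (≈⇒~ {r ++ (v ++ w)} {(r ++ v) ++ w} (R.sym (R.+-assoc r v w)))

    straighten : ∀ N u → DisorderBelow (suc N) u → Straightened N u
    straighten N []            []          = [] , [] , [] , [] , ≈⇒~ {[]} {[]} R.refl
    straighten N ((c , τ) ∷ u) (τ≤N ∷ u≤N) = straighten-∷ N c τ u τ≤N (straighten N u u≤N)

    -- After straightening u to v ++ w, still in the kernel, w vanishes.
    kernel-below : ∀ N u → DisorderBelow N u → member (Ker n) u → member I u
    kernel-below zero    [] []  _     = TwoSidedIdeal.0-closed I
    kernel-below (suc N) u  u≤N u∈Ker with straighten N u u≤N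
    ... | v , w , v<N , w∈ , u~vw = ~-member I {u} {v ++ w} u~vw
        (TwoSidedIdeal.resp I (R.sym vw≈v) (kernel-below N v v<N (TwoSidedIdeal.resp (Ker n) vw≈v vw∈Ker)))
      where
      vw∈Ker : member (Ker n) (v ++ w)
      vw∈Ker = ~-member (Ker n) {v ++ w} {u} (I⊆Ker (~-sym {u} {v ++ w} u~vw)) u∈Ker
      vw≈v : v ++ w ≈ v
      vw≈v = R.trans (R.+-congˡ {v} (avoiding-vanishes v w v<N w∈ vw∈Ker)) (R.+-identityʳ v)

    -- An ideal inside the kernel that contains all antisymmetrizers is the kernel.
    Ker-least : member (Ker n) ⊆ member I
    Ker-least {u} = kernel-below _ u (proj₂ (bounded u))
      where
      bounded : ∀ u → ∃ λ N → DisorderBelow N u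
      bounded []            = 0 , []
      bounded ((c , σ) ∷ u) = let N , u<N = bounded u in
        suc (disorder σ) ℕ.⊔ N ,
        ℕₚ.m≤m⊔n (suc (disorder σ)) N ∷
        All.map (λ lt → ℕₚ.<-≤-trans lt (ℕₚ.m≤n⊔m (suc (disorder σ)) N)) u<N

-- Ideals and quotients

module _ (R : Ring 0ℓ 0ℓ) (I : TwoSidedIdeal R) where

  ⟨⟩-least : ∀ {G} → G ⊆ member I → Generated R G ⊆ member I
  ⟨⟩-least G⊆I (gen g)       = G⊆I g
  ⟨⟩-least G⊆I (gen-≈ x≈y g) = TwoSidedIdeal.resp I x≈y (⟨⟩-least G⊆I g)
  ⟨⟩-least G⊆I gen-0         = TwoSidedIdeal.0-closed I
  ⟨⟩-least G⊆I (gen-+ g h)   = TwoSidedIdeal.+-closed I (⟨⟩-least G⊆I g) (⟨⟩-least G⊆I h)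
  ⟨⟩-least G⊆I (gen-*ˡ r g)  = TwoSidedIdeal.*-closedˡ I r (⟨⟩-least G⊆I g)
  ⟨⟩-least G⊆I (gen-*ʳ r g)  = TwoSidedIdeal.*-closedʳ I r (⟨⟩-least G⊆I g)

·-closed : (A : ℚ-Algebra) (I : TwoSidedIdeal (ℚ-Algebra.ring A)) →
  ∀ c x → member I x → member I (ℚ-Algebra._·_ A c x)
·-closed A I c x x∈I = TwoSidedIdeal.resp I (Quotient.·-via-* A I c x)
  (TwoSidedIdeal.*-closedˡ I (ℚ-Algebra._·_ A c (ℚ-Algebra.1# A)) x∈I)

module _ (A : ℚ-Algebra) (I J : TwoSidedIdeal (ℚ-Algebra.ring A)) where
  open ℚ-Algebra (A /ᴬ J) using () renaming (refl to ~-refl)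

  quotient-isomorphism : member I ≐ member J → IsℚAlgebraIsomorphism (A /ᴬ I) (A /ᴬ J) id
  quotient-isomorphism (I⊆J , J⊆I) = record
    { isRingIsomorphism = record
      { isRingMonomorphism = record
        { isRingHomomorphism = record
          { isSemiringHomomorphism = record
            { isNearSemiringHomomorphism = record
              { +-isMonoidHomomorphism = record
                { isMagmaHomomorphism = record
                  { isRelHomomorphism = record { cong = I⊆J }
                  ; homo = λ _ _ → ~-refl
                  }
                ; ε-homo = ~-refl
                }
              ; *-homo = λ _ _ → ~-refl
              }
            ; 1#-homo = ~-refl
            }
          ; -‿homo = λ _ → ~-refl
          }
        ; injective = J⊆I
        }
      ; surjective = λ x → x , I⊆J
      }
    ; ·-homo = λ _ _ → ~-refl
    }

module _ (R : Ring 0ℓ 0ℓ) (M : LeftModule R 0ℓ 0ℓ) where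
  private
    module R = Ring R
    module M = LeftModule M
  open GroupProperties R.+-group using (//-rightDividesˡ)
  open AbelianGroupProperties M.+ᴹ-abelianGroup using (∙-cancelʳ)
  open import Relation.Binary.Reasoning.Setoid M.≈ᴹ-setoid

  difference-action : ∀ r s m → (r R.- s) M.*ₗ m M.+ᴹ s M.*ₗ m M.≈ᴹ r M.*ₗ m
  difference-action r s m = begin
    (r R.- s) M.*ₗ m M.+ᴹ s M.*ₗ m   ≈⟨ M.*ₗ-distribʳ m (r R.- s) s ⟨
    ((r R.- s) R.+ s) M.*ₗ m         ≈⟨ M.*ₗ-congʳ (//-rightDividesˡ s r) ⟩
    r M.*ₗ m                         ∎

  annihilator-difference : ∀ {r s} → (∀ m → r M.*ₗ m M.≈ᴹ s M.*ₗ m) →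
    member (Annihilator R M) (r R.- s)
  annihilator-difference {r} {s} r≈s m = ∙-cancelʳ (s M.*ₗ m) _ _ (begin
    (r R.- s) M.*ₗ m M.+ᴹ s M.*ₗ m   ≈⟨ difference-action r s m ⟩
    r M.*ₗ m                         ≈⟨ r≈s m ⟩
    s M.*ₗ m                         ≈⟨ M.+ᴹ-identityˡ (s M.*ₗ m) ⟨
    M.0ᴹ M.+ᴹ s M.*ₗ m               ∎)

  annihilator-congruent : ∀ {r s} → member (Annihilator R M) (r R.- s) →
    ∀ m → r M.*ₗ m M.≈ᴹ s M.*ₗ m
  annihilator-congruent {r} {s} r-s∈ m = begin
    r M.*ₗ m                         ≈⟨ difference-action r s m ⟨
    (r R.- s) M.*ₗ m M.+ᴹ s M.*ₗ m   ≈⟨ M.+ᴹ-congʳ (r-s∈ m) ⟩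
    M.0ᴹ M.+ᴹ s M.*ₗ m               ≈⟨ M.+ᴹ-identityˡ (s M.*ₗ m) ⟩
    s M.*ₗ m                         ∎

module _ (A : ℚ-Algebra) (I : TwoSidedIdeal (ℚ-Algebra.ring A))
         (M : LeftModule (ℚ-Algebra.ring A) 0ℓ 0ℓ) where
  private
    module A = ℚ-Algebra A
    module M = LeftModule M

  quotient-module : member I ⊆ member (Annihilator A.ring M) →
    IsLeftModule (ℚ-Algebra.ring (A /ᴬ I)) M._≈ᴹ_ M._+ᴹ_ M.0ᴹ M.-ᴹ_ M._*ₗ_
  quotient-module I⊆Ann = record
    { isLeftSemimodule = record
      { +ᴹ-isCommutativeMonoid = M.+ᴹ-isCommutativeMonoid
      ; isPreleftSemimodule = record
        { *ₗ-cong = λ {_} {s} {m} r~s m≈m′ →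
            M.≈ᴹ-trans (annihilator-congruent A.ring M (I⊆Ann r~s) m) (M.*ₗ-congˡ {s} m≈m′)
        ; *ₗ-zeroˡ = M.*ₗ-zeroˡ
        ; *ₗ-distribʳ = M.*ₗ-distribʳ
        ; *ₗ-identityˡ = M.*ₗ-identityˡ
        ; *ₗ-assoc = M.*ₗ-assoc
        ; *ₗ-zeroʳ = M.*ₗ-zeroʳ
        ; *ₗ-distribˡ = M.*ₗ-distribˡ
        }
      }
    ; -ᴹ‿cong = M.-ᴹ‿cong
    ; -ᴹ‿inverse = M.-ᴹ‿inverse
    }

-- The ideals of E and of the Temperley-Lieb relators

⟨E⟩ : (n : ℕ) → 3 ≤ n → TwoSidedIdeal (ℚ𝔖-ring n)
⟨E⟩ n 3≤n = ⟨ ℚ𝔖-ring n ⟩ ｛ E₁₂₃ 3≤n ｝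

⟨TL⟩ : (n : ℕ) → TwoSidedIdeal (ℚ𝔖-ring n)
⟨TL⟩ n = ⟨ ℚ𝔖-ring n ⟩ (TLRelator n)

module _ {m : ℕ} where
  open GroupAlgebra (𝔖 (3 ℕ.+ m)) _≟ᵖ_ using (_≈_)

  E₁₂₃≈alt : E₁₂₃ (s≤s (s≤s (s≤s z≤n))) ≈ alt (transpose {3 ℕ.+ m} 0F 1F) (transpose 1F 2F)
  E₁₂₃≈alt = same-terms
    ( (refl , λ { 0F → refl ; 1F → refl ; 2F → refl ; (Fin.suc (Fin.suc (Fin.suc _))) → refl })
    ∷ (refl , λ { 0F → refl ; 1F → refl ; 2F → refl ; (Fin.suc (Fin.suc (Fin.suc _))) → refl })
    ∷ (refl , λ { 0F → refl ; 1F → refl ; 2F → refl ; (Fin.suc (Fin.suc (Fin.suc _))) → refl })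
    ∷ (refl , λ { 0F → refl ; 1F → refl ; 2F → refl ; (Fin.suc (Fin.suc (Fin.suc _))) → refl })
    ∷ (refl , λ { 0F → refl ; 1F → refl ; 2F → refl ; (Fin.suc (Fin.suc (Fin.suc _))) → refl })
    ∷ (refl , λ { 0F → refl ; 1F → refl ; 2F → refl ; (Fin.suc (Fin.suc (Fin.suc _))) → refl })
    ∷ [])

alt∈⟨E⟩ : ∀ {n} (3≤n : 3 ≤ n) {a b c : Fin n} → a ≢ b → a ≢ c → b ≢ c →
  member (⟨E⟩ n 3≤n) (alt (transpose a b) (transpose b c))
alt∈⟨E⟩ (s≤s (s≤s (s≤s z≤n))) {a} {b} {c} a≢b a≢c b≢c
  with extend-triple {p = Fin.zero} {1F} {2F} (λ ()) (λ ()) (λ ()) a≢b a≢c b≢c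
... | σ , refl , refl , refl = gen-≈
  (alt-conjugate σ {transpose 0F 1F} {transpose a b} {transpose 1F 2F} {transpose b c}
    (λ x → sym (transpose-conjugate σ 0F 1F x)) (λ x → sym (transpose-conjugate σ 1F 2F x)))
  (gen-*ʳ (single (Perm.flip σ)) (gen-*ˡ (single σ) (gen-≈ E₁₂₃≈alt (gen refl))))

consecutive : ∀ {n} (i j : Fin n) → toℕ j ≡ suc (toℕ i) →
  inject₁ j ≡ Fin.suc i × inject₁ i ≢ Fin.suc i × inject₁ i ≢ Fin.suc j × Fin.suc i ≢ Fin.suc j
consecutive i j j≡1+i =
  Finₚ.toℕ-injective (trans (Finₚ.toℕ-inject₁ j) j≡1+i) ,
  Finₚ.<⇒≢ i<1+i , Finₚ.<⇒≢ (ℕₚ.<-trans i<1+i 1+i<1+j) , Finₚ.<⇒≢ 1+i<1+j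
  where
  i<1+i : inject₁ i Fin.< Fin.suc i
  i<1+i = s≤s (ℕₚ.≤-reflexive (Finₚ.toℕ-inject₁ i))
  1+i<1+j : Fin.suc i Fin.< Fin.suc j
  1+i<1+j = s≤s (ℕₚ.≤-reflexive (sym j≡1+i))

-- Depending on which of i and j is smaller, the two simple transpositions are
-- (a b), (b c) or (c b), (b a) for consecutive positions a < b < c; the second
-- case is brought to the standard form alt (c b) (b a) by transpose-sym.
simple-alt∈ : ∀ {n} (I : TwoSidedIdeal (ℚ𝔖-ring n)) →
  (∀ {a b c} → a ≢ b → a ≢ c → b ≢ c → member I (alt (transpose a b) (transpose b c))) →
  ∀ (i j : Fin (pred n)) → toℕ j ≡ suc (toℕ i) ⊎ toℕ i ≡ suc (toℕ j) →
  member I (alt (simple {n} i) (simple {n} j))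
simple-alt∈ {suc n} I alt∈I i j (inj₁ j≡1+i) with consecutive i j j≡1+i
... | eq , a≢b , a≢c , b≢c =
  subst (λ b → member I (alt (simple {suc n} i) (transpose b (Fin.suc j)))) (sym eq)
    (alt∈I a≢b a≢c b≢c)
simple-alt∈ {suc n} I alt∈I i j (inj₂ i≡1+j) with consecutive j i i≡1+j
... | eq , a≢b , a≢c , b≢c =
  subst (λ b → member I (alt (transpose b (Fin.suc i)) (simple {suc n} j))) (sym eq)
    (TwoSidedIdeal.resp I
      (alt-cong {s = transpose (Fin.suc i) (Fin.suc j)} {transpose (Fin.suc j) (Fin.suc i)}
                {transpose (Fin.suc j) (inject₁ j)} {transpose (inject₁ j) (Fin.suc j)}
        (transpose-sym (Fin.suc i) (Fin.suc j)) (transpose-sym (Fin.suc j) (inject₁ j)))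
      (alt∈I (≢-sym b≢c) (≢-sym a≢c) (≢-sym a≢b)))

E₁₂₃∈⟨TL⟩ : ∀ {n} (3≤n : 3 ≤ n) → member (⟨TL⟩ n) (E₁₂₃ 3≤n)
E₁₂₃∈⟨TL⟩ {n} 3≤n@(s≤s (s≤s (s≤s z≤n))) = gen-≈
  (R.trans (V.*ₗ-congˡ {8ℚ} (relator-alt 0F 1F)) (R.trans 8·⅛·alt (R.sym E₁₂₃≈alt)))
  (·-closed (ℚ𝔖 n) (⟨TL⟩ n) 8ℚ _ (gen (relator 0F 1F (inj₁ refl))))
  where
  open ℚ-Algebra (ℚ𝔖 n) using (_·_; _≈_; isLeftModule)
  module V = IsLeftModule isLeftModule
  module R = Ring (ℚ𝔖-ring n)
  8ℚ = ℤ.+ 8 / 1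
  altₛ = alt (simple {n} 0F) (simple {n} 1F)
  8·⅛·alt : 8ℚ · (ℤ.1ℤ / 8) · altₛ ≈ altₛ
  8·⅛·alt = R.trans (R.sym (V.*ₗ-assoc 8ℚ (ℤ.1ℤ / 8) altₛ)) (V.*ₗ-identityˡ altₛ)

module _ {n : ℕ} (3≤n : 3 ≤ n) where

  ⟨E⟩⊆Ker : member (⟨E⟩ n 3≤n) ⊆ member (Ker n)
  ⟨E⟩⊆Ker = ⟨⟩-least (ℚ𝔖-ring n) (Ker n) λ { refl → E₁₂₃-in-kernel 3≤n }

  Ker⊆⟨E⟩ : member (Ker n) ⊆ member (⟨E⟩ n 3≤n)
  Ker⊆⟨E⟩ = Ker-least (⟨E⟩ n 3≤n) (alt∈⟨E⟩ 3≤n) ⟨E⟩⊆Ker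

  ⟨TL⟩⊆Ker : member (⟨TL⟩ n) ⊆ member (Ker n)
  ⟨TL⟩⊆Ker = ⟨⟩-least (ℚ𝔖-ring n) (Ker n) λ { (relator i j adj) →
    TwoSidedIdeal.resp (Ker n) (Ring.sym (ℚ𝔖-ring n) (relator-alt i j))
      (·-closed (ℚ𝔖 n) (Ker n) (ℤ.1ℤ / 8) (alt (simple {n} i) (simple {n} j))
        (simple-alt∈ {n} (Ker n) (λ a≢b a≢c b≢c → ⟨E⟩⊆Ker (alt∈⟨E⟩ 3≤n a≢b a≢c b≢c)) i j adj)) }

  Ker⊆⟨TL⟩ : member (Ker n) ⊆ member (⟨TL⟩ n)
  Ker⊆⟨TL⟩ u∈Ker = ⟨⟩-least (ℚ𝔖-ring n) (⟨TL⟩ n) (λ { refl → E₁₂₃∈⟨TL⟩ 3≤n }) (Ker⊆⟨E⟩ u∈Ker)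

proposition2p1 : (n : ℕ) (3≤n : 3 ≤ n) →
    let module P = LeftModule (polynomials n)
        TL-ring = ℚ-Algebra.ring (TL n)
    in TwoSidedIdeal.member (Ker n) ≐ TwoSidedIdeal.member (⟨_⟩ (ℚ𝔖-ring n) ｛ E₁₂₃ 3≤n ｝)
       × IsℚAlgebraIsomorphism (TL n) (ℚ𝔖 n /ᴬ Ker n) id
       × (Σ[ act ∈ IsLeftModule TL-ring P._≈ᴹ_ P._+ᴹ_ P.0ᴹ P.-ᴹ_ P._*ₗ_ ]
            Faithful TL-ring (record { isLeftModule = act }))
proposition2p1 n 3≤n =
  (Ker⊆⟨E⟩ 3≤n , ⟨E⟩⊆Ker 3≤n) ,
  quotient-isomorphism (ℚ𝔖 n) (⟨TL⟩ n) (Ker n) (⟨TL⟩⊆Ker 3≤n , Ker⊆⟨TL⟩ 3≤n) ,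
  quotient-module (ℚ𝔖 n) (⟨TL⟩ n) (polynomials n) (⟨TL⟩⊆Ker 3≤n) ,
  λ r s r≈s → Ker⊆⟨TL⟩ 3≤n (annihilator-difference (ℚ𝔖-ring n) (polynomials n) {r} {s} r≈s)
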